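{- If negative transition costs are allowed, then the cost-threshold problem for priced timed Petri nets (PTPN) is undecidable. That is, the following problem is undecidable: given a PTPN $\mathcal N=(Q,P,T,\mathrm{Cost})$ with $\mathrm{Cost}(p)\in\mathbb N$ for $p\in P$ and $\mathrm{Cost}(t)\in\mathbb Z$ for $t\in T$, control-states $q_{init},q_{fin}\in Q$ and a threshold $v\in\mathbb N$, decide whether $\mathrm{OptCost}(C_{init},C_{fin})\le v$, where $C_{init}=(q_{init},[])$ and $C_{fin}=\{(q_{fin},M)\mid M\in(P\times\mathbb R_{\ge 0})^{\odot}\}$.
   Context: $\mathbb N=\{0,1,2,\dots\}$. For a set $A$, $A^{\odot}$ is the set of finite multisets over $A$ (with pointwise sum and difference); $[]$ is the empty multiset. $\mathrm{Intrv}$ is the set of intervals of reals with lower bound in $\mathbb N$ and upper bound in $\mathbb N\cup\{\infty\}$; they may be open, closed or half-open. A PTPN is a tuple $\mathcal N=(Q,P,T,\mathrm{Cost})$ with $Q$ a finite set of control-states, $P$ a finite set of places, $T$ a finite set of transitions, each of the form $t=(q_1,q_2,In,Read,Out)$ with $q_1,q_2\in Q$ and $In,Read,Out\in(P\times\mathrm{Intrv})^{\odot}$, and a cost function $\mathrm{Cost}$ on $P\cup T$ (here integer-valued as specified in the claim). A configuration is a pair $(q,M)$ with $q\in Q$ and marking $M\in(P\times\mathbb R_{\ge0})^{\odot}$; an element $(p,x)$ of $M$ is a token on place $p$ with age $x$, and $|M(p)|$ is the number of tokens on $p$. $M^{+x}$ is $M$ with all token ages increased by $x$. Timed transitions: $(q,M)\to^{x}(q,M^{+x})$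 for every real $x>0$; its cost is $x\cdot\sum_{p\in P}|M(p)|\cdot\mathrm{Cost}(p)$. Discrete transitions: for a multiset $M$ of tokens and $\alpha\in(P\times\mathrm{Intrv})^{\odot}$, $\mathrm{match}(M,\alpha)$ holds iff there is a bijection from $M$ to $\alpha$ (as multisets) mapping each token $(p,x)$ to some $(p,\mathcal I)$ with $x\in\mathcal I$. For $t=(q_1,q_2,In,Read,Out)$, $(q_1,M_1)\to_t(q_2,M_2)$ iff there are $I,R,O,M'\in(P\times\mathbb R_{\ge0})^{\odot}$ with $M_1=I+R+M'$, $\mathrm{match}(I,In)$, $\mathrm{match}(R,Read)$, $\mathrm{match}(O,Out)$ and $M_2=O+R+M'$; its cost is $\mathrm{Cost}(t)$. A computation is a finite sequence of timed and discrete transitions; its cost is the sum of the costs of its transitions. $\mathrm{OptCost}(C_{init},C_{fin})$ is the infimum of the costs of all computations from $C_{init}$ to a configuration in $C_{fin}$ (with $\inf\emptyset=\infty$). -}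

module Defs where

open import Data.Nat as ℕ using (ℕ; zero; suc)
import Data.Nat.Properties as ℕₚ
open import Data.Integer as ℤ using (ℤ; +_; -[1+_])
open import Data.Rational as ℚ using (ℚ; 0ℚ; ½; ∣_∣)
import Data.Rational.Properties as ℚₚ
open import Data.Rational.Solver using (module +-*-Solver)
open import Data.Fin as Fin using (Fin; toℕ)
open import Data.List as List
  using (List; []; _∷_; _++_; map; filter; length; lookup; sum; allFin; tabulate)
import Data.List.Relation.Binary.Permutation.Propositional as Perm
import Data.List.Relation.Binary.Permutation.Setoid as SetoidPerm
open import Data.Vec as Vec using (Vec; []; _∷_)
open import Data.Product using (Σ-syntax; ∃; ∃-syntax; _×_; _,_; proj₁; proj₂)
open import Data.Product.Relation.Binary.Pointwise.NonDependent using (×-setoid)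
open import Data.Unit using (⊤)
open import Data.Sum using (_⊎_)
open import Function.Bundles using (_↔_; Inverse)
open import Level using (0ℓ)
open import Relation.Binary.Bundles using (Setoid)
open import Relation.Binary.Construct.Closure.ReflexiveTransitive as Star using (Star; _◅_)
import Relation.Binary.Construct.On as On
open import Relation.Binary.PropositionalEquality
  using (_≡_; refl; sym; trans; cong; subst; setoid)
open import Relation.Nullary using (¬_)

-- The reals: Cauchy sequences of rationals, with setoid equality _≃_.

Eventually : (ℕ → Set) → Set
Eventually P = ∃[ N ] ∀ n → N ℕ.≤ n → P n

IsCauchy : (ℕ → ℚ) → Set
IsCauchy s = ∀ ε → 0ℚ ℚ.< ε →
  ∃[ N ] ∀ m n → N ℕ.≤ m → N ℕ.≤ n → ∣ s m ℚ.- s n ∣ ℚ.< ε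

record ℝ : Set where
  constructor mkℝ
  field
    seq    : ℕ → ℚ
    cauchy : IsCauchy seq

open ℝ public

infix 4 _≃_ _≤ᴿ_ _<ᴿ_

_≃_ : ℝ → ℝ → Set
x ≃ y = ∀ ε → 0ℚ ℚ.< ε → Eventually λ n → ∣ seq x n ℚ.- seq y n ∣ ℚ.< ε

_≤ᴿ_ : ℝ → ℝ → Set
x ≤ᴿ y = ∀ ε → 0ℚ ℚ.< ε → Eventually λ n → seq x n ℚ.< seq y n ℚ.+ ε

_<ᴿ_ : ℝ → ℝ → Set
x <ᴿ y = ∃[ ε ] 0ℚ ℚ.< ε × Eventually λ n → seq x n ℚ.+ ε ℚ.< seq y n

-- Proofs about rationals are abstract: unfolding them makes type checking of
-- the later definitions diverge in practice.
abstract
  halve : ℚ → ℚ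
  halve ε = ½ ℚ.* ε

  half-pos : ∀ {ε} → 0ℚ ℚ.< ε → 0ℚ ℚ.< halve ε
  half-pos {ε} 0<ε = subst (ℚ._< ½ ℚ.* ε) (ℚₚ.*-zeroʳ ½) (ℚₚ.*-monoʳ-<-pos ½ 0<ε)

  half+half : ∀ ε → halve ε ℚ.+ halve ε ≡ ε
  half+half ε = trans (sym (ℚₚ.*-distribʳ-+ ε ½ ½)) (ℚₚ.*-identityˡ ε)

∣+∣<ε : ∀ {ε} a b → ∣ a ∣ ℚ.< halve ε → ∣ b ∣ ℚ.< halve ε → ∣ a ℚ.+ b ∣ ℚ.< ε
∣+∣<ε {ε} a b a< b< = subst (∣ a ℚ.+ b ∣ ℚ.<_) (half+half ε)
  (ℚₚ.≤-<-trans (ℚₚ.∣p+q∣≤∣p∣+∣q∣ a b) (ℚₚ.+-mono-< a< b<))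

∣x-x∣<ε : ∀ x {ε} → 0ℚ ℚ.< ε → ∣ x ℚ.- x ∣ ℚ.< ε
∣x-x∣<ε x 0<ε = subst (λ z → ∣ z ∣ ℚ.< _) (sym (ℚₚ.+-inverseʳ x)) 0<ε

_⊓ᴱ_ : ∀ {P Q R : ℕ → Set} → Eventually P → Eventually Q →
       (∀ {n} → P n → Q n → R n) → Eventually R
((N₁ , p) ⊓ᴱ (N₂ , q)) f = N₁ ℕ.⊔ N₂ , λ n N≤n →
  f (p n (ℕₚ.m⊔n≤o⇒m≤o N₁ N₂ N≤n)) (q n (ℕₚ.m⊔n≤o⇒n≤o N₁ N₂ N≤n))

abstract
  ≃-refl : ∀ {x} → x ≃ x
  ≃-refl {x} ε 0<ε = 0 , λ n _ → ∣x-x∣<ε (seq x n) 0<ε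

  ≃-sym : ∀ {x y} → x ≃ y → y ≃ x
  ≃-sym {x} {y} x≃y ε 0<ε = let N , p = x≃y ε 0<ε in N , λ n N≤n →
    subst (ℚ._< ε)
      (trans (sym (ℚₚ.∣-p∣≡∣p∣ (seq x n ℚ.- seq y n))) (cong ∣_∣ (flip- (seq x n) (seq y n))))
      (p n N≤n)
    where
    open +-*-Solver
    flip- : ∀ a b → ℚ.- (a ℚ.- b) ≡ b ℚ.- a
    flip- = solve 2 (λ a b → :- (a :- b) := b :- a) refl

  ≃-trans : ∀ {x y z} → x ≃ y → y ≃ z → x ≃ z
  ≃-trans {x} {y} {z} x≃y y≃z ε 0<ε =
    (x≃y (halve ε) (half-pos 0<ε) ⊓ᴱ y≃z (halve ε) (half-pos 0<ε)) λ {n} p q →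
      subst (λ w → ∣ w ∣ ℚ.< ε) (telescope (seq x n) (seq y n) (seq z n))
        (∣+∣<ε _ _ p q)
    where
    open +-*-Solver
    telescope : ∀ a b c → (a ℚ.- b) ℚ.+ (b ℚ.- c) ≡ a ℚ.- c
    telescope = solve 3 (λ a b c → (a :- b) :+ (b :- c) := a :- c) refl

fromℚ : ℚ → ℝ
fromℚ q = mkℝ (λ _ → q) λ ε 0<ε → 0 , λ _ _ _ _ → ∣x-x∣<ε q 0<ε

fromℤ : ℤ → ℝ
fromℤ z = fromℚ (z ℚ./ 1)

fromℕ : ℕ → ℝ
fromℕ n = fromℤ (+ n)

0ℝ : ℝ
0ℝ = fromℕ 0

abstract
  +-cauchy : ∀ x y → IsCauchy λ n → seq x n ℚ.+ seq y n
  +-cauchy x y ε 0<ε =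
    let N₁ , p = cauchy x (halve ε) (half-pos 0<ε)
        N₂ , q = cauchy y (halve ε) (half-pos 0<ε)
        l : ∀ {n} → N₁ ℕ.⊔ N₂ ℕ.≤ n → N₁ ℕ.≤ n
        l = ℕₚ.m⊔n≤o⇒m≤o N₁ N₂
        r : ∀ {n} → N₁ ℕ.⊔ N₂ ℕ.≤ n → N₂ ℕ.≤ n
        r = ℕₚ.m⊔n≤o⇒n≤o N₁ N₂
    in N₁ ℕ.⊔ N₂ , λ m n N≤m N≤n →
       subst (λ w → ∣ w ∣ ℚ.< ε) (interchange (seq x m) (seq x n) (seq y m) (seq y n))
         (∣+∣<ε _ _ (p m n (l N≤m) (l N≤n)) (q m n (r N≤m) (r N≤n)))
    where
    open +-*-Solver
    interchange : ∀ a b c d → (a ℚ.- b) ℚ.+ (c ℚ.- d) ≡ (a ℚ.+ c) ℚ.- (b ℚ.+ d)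
    interchange = solve 4 (λ a b c d → (a :- b) :+ (c :- d) := (a :+ c) :- (b :+ d)) refl

infixl 6 _+ᴿ_
infixl 7 _·_

_+ᴿ_ : ℝ → ℝ → ℝ
x +ᴿ y = mkℝ (λ n → seq x n ℚ.+ seq y n) (+-cauchy x y)

-- Only natural multiples of reals are needed, since Cost(p) ∈ ℕ and |M(p)| ∈ ℕ.
_·_ : ℕ → ℝ → ℝ
zero  · x = 0ℝ
suc n · x = x +ᴿ n · x

abstract
  +-nonNeg : ∀ {x y} → 0ℝ ≤ᴿ x → 0ℝ ≤ᴿ y → 0ℝ ≤ᴿ x +ᴿ y
  +-nonNeg {x} {y} 0≤x 0≤y ε 0<ε =
    (0≤x (halve ε) (half-pos 0<ε) ⊓ᴱ 0≤y (halve ε) (half-pos 0<ε)) λ {n} p q →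
      subst (0ℚ ℚ.<_)
        (trans (interchange (seq x n) (halve ε) (seq y n))
               (cong ((seq x n ℚ.+ seq y n) ℚ.+_) (half+half ε)))
        (ℚₚ.+-mono-< p q)
    where
    open +-*-Solver
    interchange : ∀ a h b → (a ℚ.+ h) ℚ.+ (b ℚ.+ h) ≡ (a ℚ.+ b) ℚ.+ (h ℚ.+ h)
    interchange = solve 3 (λ a h b → (a :+ h) :+ (b :+ h) := (a :+ b) :+ (h :+ h)) refl

ℝ-setoid : Setoid 0ℓ 0ℓ
ℝ-setoid = record
  { Carrier       = ℝ
  ; _≈_           = _≃_
  ; isEquivalence = record
    { refl  = λ {x} → ≃-refl {x}
    ; sym   = λ {x y} → ≃-sym {x} {y}
    ; trans = λ {x y z} → ≃-trans {x} {y} {z}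
    }
  }

ℝ≥0 : Set
ℝ≥0 = Σ[ x ∈ ℝ ] 0ℝ ≤ᴿ x

ℝ≥0-setoid : Setoid 0ℓ 0ℓ
ℝ≥0-setoid = On.setoid {B = ℝ≥0} ℝ-setoid proj₁

infixl 6 _+⁰_

_+⁰_ : ℝ≥0 → ℝ≥0 → ℝ≥0
(x , 0≤x) +⁰ (y , 0≤y) = x +ᴿ y , +-nonNeg {x} {y} 0≤x 0≤y

-- Extended reals [-∞, ∞] as upper Dedekind cuts: a is given by the rationals
-- strictly above it, so ∞ is the empty cut and -∞ the full one.  Every set of
-- reals has an infimum here without any appeal to excluded middle.

record ℝ∞ : Set₁ where
  field
    Above    : ℚ → Set
    upClosed : ∀ {q r} → Above q → q ℚ.≤ r → Above r
    rounded  : ∀ {q} → Above q → ∃[ r ] r ℚ.< q × Above r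

open ℝ∞ public

infix 4 _≤∞_

_≤∞_ : ℝ∞ → ℝ∞ → Set
a ≤∞ b = ∀ q → Above b q → Above a q

abstract
  <ᴿ-upClosed : ∀ x {q r} → x <ᴿ fromℚ q → q ℚ.≤ r → x <ᴿ fromℚ r
  <ᴿ-upClosed x (ε , 0<ε , N , p) q≤r =
    ε , 0<ε , N , λ n N≤n → ℚₚ.<-≤-trans (p n N≤n) q≤r

  <ᴿ-rounded : ∀ x {q} → x <ᴿ fromℚ q → ∃[ r ] r ℚ.< q × x <ᴿ fromℚ r
  <ᴿ-rounded x {q} (ε , 0<ε , N , p) =
    q ℚ.- halve ε
    , subst (q ℚ.- halve ε ℚ.<_) (ℚₚ.+-identityʳ q)
        (ℚₚ.+-monoʳ-< q (ℚₚ.neg-antimono-< (half-pos 0<ε)))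
    , halve ε , half-pos 0<ε , N , λ n N≤n →
        subst (ℚ._< q ℚ.- halve ε) (shift (seq x n))
          (ℚₚ.+-monoˡ-< (ℚ.- (halve ε)) (p n N≤n))
    where
    open +-*-Solver
    cancel : ∀ a h → (a ℚ.+ (h ℚ.+ h)) ℚ.- h ≡ a ℚ.+ h
    cancel = solve 2 (λ a h → (a :+ (h :+ h)) :- h := a :+ h) refl
    shift : ∀ a → (a ℚ.+ ε) ℚ.- halve ε ≡ a ℚ.+ halve ε
    shift a = trans (cong (λ e → (a ℚ.+ e) ℚ.- halve ε) (sym (half+half ε)))
                    (cancel a (halve ε))

↑_ : ℝ → ℝ∞
↑ x = record
  { Above    = λ q → x <ᴿ fromℚ q
  ; upClosed = <ᴿ-upClosed x
  ; rounded  = <ᴿ-rounded x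
  }

inf : (ℝ → Set) → ℝ∞
inf S = record
  { Above    = λ q → ∃[ x ] S x × x <ᴿ fromℚ q
  ; upClosed = λ (x , x∈S , x<q) q≤r → x , x∈S , <ᴿ-upClosed x x<q q≤r
  ; rounded  = λ (x , x∈S , x<q) →
      let r , r<q , x<r = <ᴿ-rounded x x<q in r , r<q , x , x∈S , x<r
  }

inf-lowerBound : ∀ S {x} → S x → inf S ≤∞ ↑ x
inf-lowerBound S {x} x∈S q x<q = x , x∈S , x<q

inf-greatest : ∀ S a → (∀ {x} → S x → a ≤∞ ↑ x) → a ≤∞ inf S
inf-greatest S a bound q (x , x∈S , x<q) = bound x∈S q x<q

-- Finite multisets are lists up to permutation, and
-- finite sets (of control-states, places, transitions) are enumerated by Fin.

-- Bounds that leave no real in between are allowed and denote the empty interval.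
data LowerBound : Set where
  closed strict : ℕ → LowerBound

data UpperBound : Set where
  closed strict : ℕ → UpperBound
  ∞             : UpperBound

Intrv : Set
Intrv = LowerBound × UpperBound

infix 4 _∈ᴵ_

_≥ˡ_ : ℝ → LowerBound → Set
x ≥ˡ closed a = fromℕ a ≤ᴿ x
x ≥ˡ strict a = fromℕ a <ᴿ x

_≤ᵘ_ : ℝ → UpperBound → Set
x ≤ᵘ closed b = x ≤ᴿ fromℕ b
x ≤ᵘ strict b = x <ᴿ fromℕ b
x ≤ᵘ ∞        = ⊤

_∈ᴵ_ : ℝ → Intrv → Set
x ∈ᴵ (l , u) = x ≥ˡ l × x ≤ᵘ u

record Transition (nQ nP : ℕ) : Set where
  field
    source target : Fin nQ
    In Read Out   : List (Fin nP × Intrv)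

open Transition public

record _≈ᵗ_ {nQ nP} (t u : Transition nQ nP) : Set where
  field
    source-≡ : source t ≡ source u
    target-≡ : target t ≡ target u
    In-↭     : In t   Perm.↭ In u
    Read-↭   : Read t Perm.↭ Read u
    Out-↭    : Out t  Perm.↭ Out u

record PTPN : Set where
  field
    nQ nP nT   : ℕ
    transition : Fin nT → Transition nQ nP
    -- T is a set: a transition is listed once and so has just one cost.
    distinct   : ∀ i j → transition i ≈ᵗ transition j → i ≡ j
    costP      : Fin nP → ℕ
    costT      : Fin nT → ℤ

module Semantics (𝒩 : PTPN) where
  open PTPN 𝒩

  Token : Set
  Token = Fin nP × ℝ≥0

  Marking : Set
  Marking = List Token

  open SetoidPerm (×-setoid (setoid (Fin nP)) ℝ≥0-setoid) public using (_↭_)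

  Config : Set
  Config = Fin nQ × Marking

  ∣_∣at_ : Marking → Fin nP → ℕ
  ∣ M ∣at p = length (filter (λ tok → proj₁ tok Fin.≟ p) M)

  _^+_ : Marking → ℝ≥0 → Marking
  M ^+ x = map (λ (p , a) → p , a +⁰ x) M

  Match : Marking → List (Fin nP × Intrv) → Set
  Match M α = Σ[ f ∈ Fin (length M) ↔ Fin (length α) ]
    (∀ i → let (p , x , _) = lookup M i
               (p′ , 𝓘)    = lookup α (Inverse.to f i)
           in p ≡ p′ × x ∈ᴵ 𝓘)

  data Step : Config → Config → Set where
    timed : ∀ {q M M′} (x : ℝ≥0) → 0ℝ <ᴿ proj₁ x → M′ ↭ M ^+ x →
            Step (q , M) (q , M′)
    fire  : ∀ {q₁ q₂ M₁ M₂} (i : Fin nT) (I R O M′ : Marking) →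
            q₁ ≡ source (transition i) → q₂ ≡ target (transition i) →
            M₁ ↭ I ++ R ++ M′ →
            Match I (In (transition i)) → Match R (Read (transition i)) → Match O (Out (transition i)) →
            M₂ ↭ O ++ R ++ M′ →
            Step (q₁ , M₁) (q₂ , M₂)

  stepCost : ∀ {C D} → Step C D → ℝ
  stepCost (timed {M = M} x _ _) =
    sum (map (λ p → ∣ M ∣at p ℕ.* costP p) (allFin nP)) · proj₁ x
  stepCost (fire i _ _ _ _ _ _ _ _ _ _ _) = fromℤ (costT i)

  Computation : Config → Config → Set
  Computation = Star Step

  cost : ∀ {C D} → Computation C D → ℝ
  cost Star.ε  = 0ℝ
  cost (s ◅ π) = stepCost s +ᴿ cost π

  OptCost : Config → (Config → Set) → ℝ∞
  OptCost C C-fin = inf λ c → ∃[ D ] C-fin D × Σ[ π ∈ Computation C D ] c ≡ cost π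

record Instance : Set where
  field
    net           : PTPN
  open PTPN net public
  field
    q-init q-fin  : Fin nQ
    threshold     : ℕ

CostThreshold : Instance → Set
CostThreshold 𝓘 = OptCost C-init C-fin ≤∞ ↑ fromℕ threshold
  where
  open Instance 𝓘
  open Semantics net
  C-init : Config
  C-init = q-init , []
  C-fin : Config → Set
  C-fin (q , M) = q ≡ q-fin

triangle : ℕ → ℕ
triangle zero    = 0
triangle (suc n) = suc n ℕ.+ triangle n

-- Cantor's bijection ℕ × ℕ → ℕ; hence distinct instances get distinct codes
-- (up to the order in which transitions and multisets are listed).
⟨_,_⟩ : ℕ → ℕ → ℕ
⟨ a , b ⟩ = triangle (a ℕ.+ b) ℕ.+ b

encodeList : List ℕ → ℕ
encodeList []       = 0
encodeList (a ∷ as) = suc ⟨ a , encodeList as ⟩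

encodeℤ : ℤ → ℕ
encodeℤ (+ n)    = ⟨ 0 , n ⟩
encodeℤ -[1+ n ] = ⟨ 1 , n ⟩

encodeLower : LowerBound → ℕ
encodeLower (closed a) = ⟨ 0 , a ⟩
encodeLower (strict a) = ⟨ 1 , a ⟩

encodeUpper : UpperBound → ℕ
encodeUpper (closed b) = ⟨ 0 , b ⟩
encodeUpper (strict b) = ⟨ 1 , b ⟩
encodeUpper ∞          = ⟨ 2 , 0 ⟩

encodeArcs : ∀ {nP} → List (Fin nP × Intrv) → ℕ
encodeArcs α = encodeList (map (λ (p , l , u) → ⟨ toℕ p , ⟨ encodeLower l , encodeUpper u ⟩ ⟩) α)

encodeTransition : ∀ {nQ nP} → Transition nQ nP → ℕ
encodeTransition t =
  ⟨ toℕ (source t) , ⟨ toℕ (target t) ,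
  ⟨ encodeArcs (In t) , ⟨ encodeArcs (Read t) , encodeArcs (Out t) ⟩ ⟩ ⟩ ⟩

encodePTPN : PTPN → ℕ
encodePTPN 𝒩 =
  ⟨ nQ ,
  ⟨ encodeList (tabulate costP) ,
    encodeList (tabulate λ i → ⟨ encodeTransition (transition i) , encodeℤ (costT i) ⟩) ⟩ ⟩
  where open PTPN 𝒩

encode : Instance → ℕ
encode 𝓘 = ⟨ encodePTPN net , ⟨ toℕ q-init , ⟨ toℕ q-fin , threshold ⟩ ⟩ ⟩
  where open Instance 𝓘

-- μ-recursive functions; f [ xs ]⇓ y means that f is defined at xs with value y.
data Rec : ℕ → Set where
  zer  : Rec 0
  succ : Rec 1
  proj : ∀ {n} → Fin n → Rec n
  comp : ∀ {m n} → Rec m → Vec (Rec n) m → Rec n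
  prec : ∀ {n} → Rec n → Rec (2 ℕ.+ n) → Rec (1 ℕ.+ n)
  mu   : ∀ {n} → Rec (1 ℕ.+ n) → Rec n

infix 4 _[_]⇓_ _[_]⇓*_

mutual
  data _[_]⇓_ : ∀ {n} → Rec n → Vec ℕ n → ℕ → Set where
    ⇓zer   : zer [ [] ]⇓ 0
    ⇓succ  : ∀ {x} → succ [ x ∷ [] ]⇓ suc x
    ⇓proj  : ∀ {n} {i : Fin n} {xs} → proj i [ xs ]⇓ Vec.lookup xs i
    ⇓comp  : ∀ {m n} {f : Rec m} {gs : Vec (Rec n) m} {xs ys z} →
             gs [ xs ]⇓* ys → f [ ys ]⇓ z → comp f gs [ xs ]⇓ z
    ⇓prec0 : ∀ {n} {f : Rec n} {g xs z} →
             f [ xs ]⇓ z → prec f g [ 0 ∷ xs ]⇓ z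
    ⇓precS : ∀ {n} {f : Rec n} {g xs k y z} →
             prec f g [ k ∷ xs ]⇓ y → g [ k ∷ y ∷ xs ]⇓ z → prec f g [ suc k ∷ xs ]⇓ z
    ⇓mu    : ∀ {n} {f : Rec (1 ℕ.+ n)} {xs y} →
             (∀ k → k ℕ.< y → ∃[ w ] f [ k ∷ xs ]⇓ suc w) →
             f [ y ∷ xs ]⇓ 0 → mu f [ xs ]⇓ y

  data _[_]⇓*_ : ∀ {m n} → Vec (Rec n) m → Vec ℕ n → Vec ℕ m → Set where
    []  : ∀ {n} {xs : Vec ℕ n} → [] [ xs ]⇓* []
    _∷_ : ∀ {m n} {g : Rec n} {gs : Vec (Rec n) m} {xs y ys} →
          g [ xs ]⇓ y → gs [ xs ]⇓* ys → (g ∷ gs) [ xs ]⇓* (y ∷ ys)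

-- The behaviour of the decider on numbers that encode no instance is irrelevant.
AlgorithmicallyDecidable : {A : Set} → (A → ℕ) → (A → Set) → Set
AlgorithmicallyDecidable code P = ∃[ f ] ∀ a →
  (f [ code a ∷ [] ]⇓ 1 × P a) ⊎ (f [ code a ∷ [] ]⇓ 0 × ¬ P a)

Undecidable : {A : Set} → (A → ℕ) → (A → Set) → Set
Undecidable code P = ¬ AlgorithmicallyDecidable code P

{-# OPTIONS --safe #-}

-- Zero tests are enforced by cost.  A net simulates a counter machine with one token per
-- counter unit.  All places cost 1 and every edge of the machine lasts one time unit,
-- measured by a clock token, so that delays cost exactly the increase of the total age;
-- then each token of age at least 1 may be renewed for a refund of 1.  Hence the cost is at
-- least the final total age minus the initial one, and an honest run can be completed at
-- cost 0.  On an edge that tests r for zero the tokens on r earn no refund: a false test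
-- loses one unit for good, and the cost is at least 1.  So with threshold 0 the problem asks
-- whether the counter machine accepts.
--
-- A decider f is refuted by diagonalisation.  A machine that accepts iff f answers 0 on
-- diagonal (a , b , c) is turned into a net whose first transition loads the numbers
-- a, b, c that describe the rest of the net, so that diagonal (a , b , c) is the code of
-- that very net.

module Submission where

open import Defs
open import Data.Bool using (Bool; true; false; not; if_then_else_)
open import Data.Empty using (⊥)
open import Data.Fin as Fin using (Fin; zero; suc; toℕ; _≟_; _↑ˡ_; _↑ʳ_; splitAt; join)
open import Data.Fin.Permutation using (Permutation; _⟨$⟩ʳ_; ↔⇒≡)
import Data.Fin.Properties as Finₚ
open import Data.Integer as ℤ using (ℤ; -[1+_])
open import Data.List as List
  using (List; []; _∷_; _++_; _ʳ++_; map; length; allFin; tabulate; replicate)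
import Data.List.Properties as Listₚ
open import Data.List.Membership.Propositional using (_∈_; _∉_)
open import Data.List.Membership.Propositional.Properties using (∈-lookup; ∈-∃++)
import Data.List.Relation.Binary.Permutation.Homogeneous as ↭
import Data.List.Relation.Binary.Permutation.Propositional as Perm
import Data.List.Relation.Binary.Permutation.Propositional.Properties as Permₚ
import Data.List.Relation.Binary.Permutation.Setoid as SetoidPerm
import Data.List.Relation.Binary.Permutation.Setoid.Properties as SetoidPermₚ
open import Data.List.Relation.Binary.Pointwise as Pointwise using (Pointwise; []; _∷_)
open import Data.List.Relation.Unary.All as All using (All; []; _∷_)
import Data.List.Relation.Unary.All.Properties as Allₚ
open import Data.List.Relation.Unary.Any as Any using (Any; here; there)
import Data.List.Relation.Unary.Any.Properties as Anyₚ
open import Data.Nat as ℕ using (ℕ; zero; suc; _+_; _*_; _∸_)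
open import Data.Nat.ListAction using (sum)
import Data.Nat.Properties as ℕₚ
open import Data.Nat.Solver using () renaming (module +-*-Solver to ℕ-Solver)
open import Data.Product using (_×_; _,_; proj₁; proj₂; uncurry; Σ-syntax; ∃-syntax)
open import Data.Product.Relation.Binary.Pointwise.NonDependent using (×-setoid)
open import Data.Rational as ℚ using (ℚ; 0ℚ; 1ℚ; ½; ∣_∣)
import Data.Rational.Properties as ℚₚ
open import Data.Rational.Solver using () renaming (module +-*-Solver to ℚ-Solver)
open import Data.Sum using (_⊎_; inj₁; inj₂; [_,_]′)
open import Data.Unit using (⊤; tt)
open import Data.Vec as Vec using (Vec; []; _∷_; lookup; updateAt; _[_]≔_)
import Data.Vec.Properties as Vecₚ
open import Function using (_∘_)
open import Function.Bundles using (Inverse; mk↔ₛ′)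
open import Relation.Binary.Construct.Closure.ReflexiveTransitive as Star using (Star; _◅_; _◅◅_)
open import Relation.Binary.PropositionalEquality
  using (_≡_; _≢_; _≗_; refl; sym; trans; cong; cong₂; subst; subst₂; setoid; module ≡-Reasoning)
open import Relation.Nullary using (¬_; yes; no; does; contradiction)
open import Relation.Nullary.Decidable using (dec-true; dec-false)
open import Algebra.Properties.CommutativeMonoid.Sum ℕₚ.+-0-commutativeMonoid
  using (sum-permute; sum-cong-≗; ∑-distrib-+; sum-replicate-zero) renaming (sum to ∑)

-- The threshold speaks of an infimum over computations with arbitrary real delays, so it would not
-- be enough that every false test loses something: the losses have to stay away from 0. This is why
-- an edge must last at least a full time unit. A token that is denied its refund during that unit
-- keeps an excess age of 1, and no later edge makes up for it, because the token ages by another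
-- unit there while its refund is at most 1. The excess is lost when the token is renewed or
-- consumed, or it remains in the final age.
--
-- The self-reference needs no fixed-point theorem. The machine applies f to the value of `diagonal`
-- on three of its registers and contains no numeral of its own description; only the loading
-- transition puts such numbers into the net. Control-states, place costs and all other transitions
-- are the same for every load, so a, b, c can be computed for the empty load and inserted
-- afterwards.

-- The order on the reals

infix 4 _≼_

-- _≤ᴿ_ unfolds to a function type from which its arguments cannot be inferred.
record _≼_ (x y : ℝ) : Set where
  constructor ≤⇒≼
  field ≼⇒≤ : x ≤ᴿ y

open _≼_ public

abstract
  <+ε : ∀ q {ε} → 0ℚ ℚ.< ε → q ℚ.< q ℚ.+ ε
  <+ε q {ε} 0<ε = subst (ℚ._< q ℚ.+ ε) (ℚₚ.+-identityʳ q) (ℚₚ.+-monoʳ-< q 0<ε)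

  pointwise-≼ : ∀ {x y} → (∀ n → seq x n ≡ seq y n) → x ≼ y
  pointwise-≼ {x} {y} x≡y = ≤⇒≼ λ ε 0<ε → 0 , λ n _ →
    subst (ℚ._< seq y n ℚ.+ ε) (sym (x≡y n)) (<+ε (seq y n) 0<ε)

  ≼-trans : ∀ {x y z} → x ≼ y → y ≼ z → x ≼ z
  ≼-trans {x} {y} {z} (≤⇒≼ x≤y) (≤⇒≼ y≤z) = ≤⇒≼ λ ε 0<ε →
    (x≤y (halve ε) (half-pos 0<ε) ⊓ᴱ y≤z (halve ε) (half-pos 0<ε)) λ {n} p q →
      subst (seq x n ℚ.<_)
        (trans (ℚₚ.+-assoc (seq z n) (halve ε) (halve ε)) (cong (seq z n ℚ.+_) (half+half ε)))
        (ℚₚ.<-trans p (ℚₚ.+-monoˡ-< (halve ε) q))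

  +-mono-≼ : ∀ {x y u v} → x ≼ y → u ≼ v → x +ᴿ u ≼ y +ᴿ v
  +-mono-≼ {x} {y} {u} {v} (≤⇒≼ x≤y) (≤⇒≼ u≤v) = ≤⇒≼ λ ε 0<ε →
    (x≤y (halve ε) (half-pos 0<ε) ⊓ᴱ u≤v (halve ε) (half-pos 0<ε)) λ {n} p q →
      subst (seq x n ℚ.+ seq u n ℚ.<_)
        (trans (interchange (seq y n) (halve ε) (seq v n))
               (cong ((seq y n ℚ.+ seq v n) ℚ.+_) (half+half ε)))
        (ℚₚ.+-mono-< p q)
    where
    open ℚ-Solver
    interchange : ∀ a h b → (a ℚ.+ h) ℚ.+ (b ℚ.+ h) ≡ (a ℚ.+ b) ℚ.+ (h ℚ.+ h)
    interchange = solve 3 (λ a h b → (a :+ h) :+ (b :+ h) := (a :+ b) :+ (h :+ h)) refl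

  ≃⇒≼ : ∀ x y → x ≃ y → x ≼ y
  ≃⇒≼ x y x≃y = ≤⇒≼ λ ε 0<ε → let N , p = x≃y ε 0<ε in N , λ n N≤n →
    subst (ℚ._< seq y n ℚ.+ ε) (cancel (seq x n) (seq y n))
      (ℚₚ.+-monoʳ-< (seq y n) (ℚₚ.≤-<-trans (p≤∣p∣ (seq x n ℚ.- seq y n)) (p n N≤n)))
    where
    open ℚ-Solver
    cancel : ∀ a b → b ℚ.+ (a ℚ.- b) ≡ a
    cancel = solve 2 (λ a b → b :+ (a :- b) := a) refl
    p≤∣p∣ : ∀ p → p ℚ.≤ ∣ p ∣
    p≤∣p∣ p with ℚₚ.≤-total 0ℚ p
    ... | inj₁ 0≤p = ℚₚ.≤-reflexive (sym (ℚₚ.0≤p⇒∣p∣≡p 0≤p))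
    ... | inj₂ p≤0 = ℚₚ.≤-trans p≤0 (ℚₚ.0≤∣p∣ p)

  0≼1 : 0ℝ ≼ fromℕ 1
  0≼1 = ≤⇒≼ λ ε 0<ε → 0 , λ n _ →
    ℚₚ.<-trans (ℚₚ.positive⁻¹ 1ℚ) (<+ε 1ℚ 0<ε)

  1≼⇒≮½ : ∀ x → fromℕ 1 ≼ x → ¬ (x <ᴿ fromℚ ℚ.½)
  1≼⇒≮½ x (≤⇒≼ 1≤x) (ε , 0<ε , N , p) = let M , q = 1≤x ε 0<ε in
    ℚₚ.<-asym {1ℚ} {ℚ.½}
      (ℚₚ.<-trans (q (N ℕ.⊔ M) (ℕₚ.m≤n⊔m N M)) (p (N ℕ.⊔ M) (ℕₚ.m≤m⊔n N M)))
      (ℚ.*<* (ℤ.+<+ (ℕ.s≤s (ℕ.s≤s ℕ.z≤n))))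

abstract
  positive⇒0<ᴿ : ∀ {q} → 0ℚ ℚ.< q → 0ℝ <ᴿ fromℚ q
  positive⇒0<ᴿ {q} 0<q = halve q , half-pos 0<q , 0 , λ _ _ →
    subst (ℚ._< q) (sym (ℚₚ.+-identityˡ (halve q)))
      (subst (halve q ℚ.<_) (half+half q) (<+ε (halve q) (half-pos 0<q)))

  0ℝ<½ : 0ℝ <ᴿ fromℚ ℚ.½
  0ℝ<½ = positive⇒0<ᴿ (ℚₚ.positive⁻¹ ℚ.½)

  0ℝ<1 : 0ℝ <ᴿ fromℕ 1
  0ℝ<1 = positive⇒0<ᴿ (ℚₚ.positive⁻¹ 1ℚ)

abstract
  ≼-<-trans : ∀ {x y z} → x ≼ y → y <ᴿ z → x <ᴿ z
  ≼-<-trans {x} {y} {z} (≤⇒≼ x≤y) (ε , 0<ε , y<z) =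
    halve ε , half-pos 0<ε , (x≤y (halve ε) (half-pos 0<ε) ⊓ᴱ y<z) λ {n} p q →
      ℚₚ.<-trans (subst (seq x n ℚ.+ halve ε ℚ.<_)
        (trans (ℚₚ.+-assoc (seq y n) (halve ε) (halve ε)) (cong (seq y n ℚ.+_) (half+half ε)))
        (ℚₚ.+-monoˡ-< (halve ε) p)) q

≼-refl : ∀ {x} → x ≼ x
≼-refl = pointwise-≼ λ _ → refl

+-comm-≼ : ∀ {x y} → x +ᴿ y ≼ y +ᴿ x
+-comm-≼ {x} {y} = pointwise-≼ λ n → ℚₚ.+-comm (seq x n) (seq y n)

+-assoc-≼ : ∀ {x y z} → (x +ᴿ y) +ᴿ z ≼ x +ᴿ (y +ᴿ z)
+-assoc-≼ {x} {y} {z} = pointwise-≼ λ n → ℚₚ.+-assoc (seq x n) (seq y n) (seq z n)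

+-assoc′-≼ : ∀ {x y z} → x +ᴿ (y +ᴿ z) ≼ (x +ᴿ y) +ᴿ z
+-assoc′-≼ {x} {y} {z} = pointwise-≼ λ n → sym (ℚₚ.+-assoc (seq x n) (seq y n) (seq z n))

+-identityˡ-≼ : ∀ {x} → 0ℝ +ᴿ x ≼ x
+-identityˡ-≼ {x} = pointwise-≼ λ n → ℚₚ.+-identityˡ (seq x n)

+-identityˡ′-≼ : ∀ {x} → x ≼ 0ℝ +ᴿ x
+-identityˡ′-≼ {x} = pointwise-≼ λ n → sym (ℚₚ.+-identityˡ (seq x n))

+-identityʳ-≼ : ∀ {x} → x +ᴿ 0ℝ ≼ x
+-identityʳ-≼ {x} = pointwise-≼ λ n → ℚₚ.+-identityʳ (seq x n)

+-identityʳ′-≼ : ∀ {x} → x ≼ x +ᴿ 0ℝ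
+-identityʳ′-≼ {x} = pointwise-≼ λ n → sym (ℚₚ.+-identityʳ (seq x n))

-- Counting occurrences

δ : ∀ {k} → Fin k → Fin k → ℕ
δ i j = if does (i ≟ j) then 1 else 0

δ-refl : ∀ {k} (i : Fin k) → δ i i ≡ 1
δ-refl i rewrite dec-true (i ≟ i) refl = refl

δ-≢ : ∀ {k} {i j : Fin k} → i ≢ j → δ i j ≡ 0
δ-≢ {i = i} {j} i≢j rewrite dec-false (i ≟ j) i≢j = refl

infix 8 _#_

_#_ : ∀ {k} → List (Fin k) → Fin k → ℕ
[]      # j = 0
(i ∷ l) # j = δ i j + l # j

#-++ : ∀ {k} (l l′ : List (Fin k)) j → (l ++ l′) # j ≡ l # j + l′ # j
#-++ []      l′ j = refl
#-++ (i ∷ l) l′ j = trans (cong (δ i j +_) (#-++ l l′ j)) (sym (ℕₚ.+-assoc (δ i j) _ _))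

#-map-suc : ∀ {k} (l : List (Fin k)) j → map Fin.suc l # suc j ≡ l # j
#-map-suc []      j = refl
#-map-suc (i ∷ l) j = cong (δ i j +_) (#-map-suc l j)

#-map-suc-zero : ∀ {k} (l : List (Fin k)) → map Fin.suc l # zero ≡ 0
#-map-suc-zero []      = refl
#-map-suc-zero (i ∷ l) = #-map-suc-zero l

#≡0⇒∉ : ∀ {k} {l : List (Fin k)} {j} → l # j ≡ 0 → j ∉ l
#≡0⇒∉ {l = i ∷ l} {j} eq (here refl) = contradiction (trans (sym (δ-refl j)) (ℕₚ.m+n≡0⇒m≡0 (δ j j) eq)) λ ()
#≡0⇒∉ {l = i ∷ l} {j} eq (there j∈l) = #≡0⇒∉ (ℕₚ.m+n≡0⇒n≡0 (δ i j) eq) j∈l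

#≢0⇒∈ : ∀ {k} (l : List (Fin k)) {j} → l # j ≢ 0 → j ∈ l
#≢0⇒∈ []      ≢0 = contradiction refl ≢0
#≢0⇒∈ (i ∷ l) {j} ≢0 with i ≟ j
... | yes refl = here refl
... | no _     = there (#≢0⇒∈ l ≢0)

#-∑ : ∀ {A : Set} {k} (f : A → Fin k) (xs : List A) j →
      map f xs # j ≡ ∑ (λ i → δ (f (List.lookup xs i)) j)
#-∑ f []       j = refl
#-∑ f (x ∷ xs) j = cong (δ (f x) j +_) (#-∑ f xs j)

#-bijection : ∀ {A B : Set} {k} (f : A → Fin k) (g : B → Fin k) (xs : List A) (ys : List B)
              (π : Permutation (length xs) (length ys)) →
              (∀ i → f (List.lookup xs i) ≡ g (List.lookup ys (π ⟨$⟩ʳ i))) →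
              ∀ j → map f xs # j ≡ map g ys # j
#-bijection f g xs ys π eq j = begin
  map f xs # j                                  ≡⟨ #-∑ f xs j ⟩
  ∑ (λ i → δ (f (List.lookup xs i)) j)               ≡⟨ sum-cong-≗ (λ i → cong (λ k → δ k j) (eq i)) ⟩
  -- A bijection of positions merely permutes the summands; this is why occurrences are rewritten as
  -- a sum over positions.
  ∑ (λ i → δ (g (List.lookup ys (π ⟨$⟩ʳ i))) j)      ≡⟨ sum-permute (λ i → δ (g (List.lookup ys i)) j) π ⟨
  ∑ (λ i → δ (g (List.lookup ys i)) j)               ≡⟨ #-∑ g ys j ⟨
  map g ys # j                                  ∎
  where open ≡-Reasoning

∑-δ : ∀ {k} (i : Fin k) → ∑ (δ i) ≡ 1
∑-δ {suc k} zero    = cong suc (sum-replicate-zero k)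
∑-δ         (suc i) = ∑-δ i

∑-# : ∀ {k} (l : List (Fin k)) → ∑ (l #_) ≡ length l
∑-# {k} []  = sum-replicate-zero k
∑-# (i ∷ l) = trans (∑-distrib-+ (δ i) (l #_)) (cong₂ _+_ (∑-δ i) (∑-# l))

sum-allFin : ∀ {k} (f : Fin k → ℕ) → sum (map f (allFin k)) ≡ ∑ f
sum-allFin {zero}  f = refl
sum-allFin {suc k} f = cong (f zero +_) (trans (cong sum (trans (Listₚ.map-tabulate suc f)
  (sym (Listₚ.map-tabulate (λ i → i) (f ∘ suc))))) (sum-allFin (f ∘ suc)))

-- Markings, ages and matchings

module Markings (𝒩 : PTPN) where
  open PTPN 𝒩
  open Semantics 𝒩

  places : Marking → List (Fin nP)
  places = map proj₁

  age : Token → ℝ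
  age (_ , x , _) = x

  ages : Marking → ℝ
  ages []        = 0ℝ
  ages (tok ∷ M) = age tok +ᴿ ages M

  ≈⇒≼ : ∀ {x y : ℝ≥0} → proj₁ x ≃ proj₁ y → proj₁ x ≼ proj₁ y
  ≈⇒≼ {x} {y} = ≃⇒≼ (proj₁ x) (proj₁ y)

  #-↭ : ∀ {M N} → M ↭ N → ∀ p → places M # p ≡ places N # p
  #-↭ (↭.refl [])                      p = refl
  #-↭ (↭.refl (_∷_ {x = q , _} (refl , _) M≋N)) p = cong (δ q p ℕ.+_) (#-↭ (↭.refl M≋N) p)
  #-↭ (↭.prep {x = q , _} (refl , _) M↭N)        p = cong (δ q p ℕ.+_) (#-↭ M↭N p)
  #-↭ (↭.swap {xs = M} {ys = N} {x = q , _} {y = r , _} (refl , _) (refl , _) M↭N) p = begin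
    δ q p ℕ.+ (δ r p ℕ.+ places M # p) ≡⟨ ℕₚ.+-assoc (δ q p) (δ r p) _ ⟨
    δ q p ℕ.+ δ r p ℕ.+ places M # p   ≡⟨ cong₂ ℕ._+_ (ℕₚ.+-comm (δ q p) (δ r p)) (#-↭ M↭N p) ⟩
    δ r p ℕ.+ δ q p ℕ.+ places N # p   ≡⟨ ℕₚ.+-assoc (δ r p) (δ q p) _ ⟩
    δ r p ℕ.+ (δ q p ℕ.+ places N # p) ∎
    where open ≡-Reasoning
  #-↭ (↭.trans M↭N N↭K)                p = trans (#-↭ M↭N p) (#-↭ N↭K p)

  ages-↭ : ∀ {M N} → M ↭ N → ages M ≼ ages N
  ages-↭ (↭.refl [])                           = ≼-refl
  ages-↭ (↭.refl (_∷_ {_ , x} {_ , y} (_ , e) M≋N)) = +-mono-≼ (≈⇒≼ {x} {y} e) (ages-↭ (↭.refl M≋N))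
  ages-↭ (↭.prep {x = _ , x} {_ , y} (_ , e) M↭N) = +-mono-≼ (≈⇒≼ {x} {y} e) (ages-↭ M↭N)
  ages-↭ (↭.swap {x = _ , x} {y = _ , y} {_ , x′} {_ , y′} (_ , e) (_ , d) M↭N) =
    ≼-trans +-assoc′-≼ (≼-trans
      (+-mono-≼ (≼-trans +-comm-≼ (+-mono-≼ (≈⇒≼ {y} {y′} d) (≈⇒≼ {x} {x′} e))) (ages-↭ M↭N)) +-assoc-≼)
  ages-↭ (↭.trans M↭N N↭K)                     = ≼-trans (ages-↭ M↭N) (ages-↭ N↭K)

  ages-++-≡ : ∀ M N n → seq (ages (M ++ N)) n ≡ seq (ages M +ᴿ ages N) n
  ages-++-≡ []              N n = sym (ℚₚ.+-identityˡ _)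
  ages-++-≡ ((_ , x , _) ∷ M) N n =
    trans (cong (seq x n ℚ.+_) (ages-++-≡ M N n)) (sym (ℚₚ.+-assoc (seq x n) _ _))

  ages-++ : ∀ M N → ages (M ++ N) ≼ ages M +ᴿ ages N
  ages-++ M N = pointwise-≼ (ages-++-≡ M N)

  ages-++′ : ∀ M N → ages M +ᴿ ages N ≼ ages (M ++ N)
  ages-++′ M N = pointwise-≼ (sym ∘ ages-++-≡ M N)

  -- With all prices 1, `length M · x` is the cost of the delay, so this is the law that a delay
  -- costs exactly the increase of the total age. It holds term by term, which yields inequalities
  -- in both directions.
  ages-^+-≡ : ∀ M x n → seq (ages (M ^+ x)) n ≡ seq (length M · proj₁ x +ᴿ ages M) n
  ages-^+-≡ []              x n = refl
  ages-^+-≡ ((_ , y , _) ∷ M) x n = trans (cong (seq y n ℚ.+ seq (proj₁ x) n ℚ.+_) (ages-^+-≡ M x n))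
    (rearrange (seq y n) (seq (proj₁ x) n) (seq (length M · proj₁ x) n) (seq (ages M) n))
    where
    open ℚ-Solver
    rearrange : ∀ a b c d → (a ℚ.+ b) ℚ.+ (c ℚ.+ d) ≡ (b ℚ.+ c) ℚ.+ (a ℚ.+ d)
    rearrange = solve 4 (λ a b c d → (a :+ b) :+ (c :+ d) := (b :+ c) :+ (a :+ d)) refl

  0≼ages : ∀ M → 0ℝ ≼ ages M
  0≼ages []                = ≼-refl
  0≼ages ((_ , _ , 0≤x) ∷ M) = ≼-trans +-identityˡ′-≼ (+-mono-≼ (≤⇒≼ 0≤x) (0≼ages M))

  age≼ages : ∀ {c M} → Any (λ tok → c ≼ age tok) M → c ≼ ages M
  age≼ages {M = _ ∷ M} (here c≼x) = ≼-trans +-identityʳ′-≼ (+-mono-≼ c≼x (0≼ages M))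
  age≼ages {M = (_ , _ , 0≤x) ∷ _} (there c∈M) =
    ≼-trans +-identityˡ′-≼ (+-mono-≼ (≤⇒≼ 0≤x) (age≼ages c∈M))

  ages≼0 : ∀ {M} → All (λ tok → age tok ≼ 0ℝ) M → ages M ≼ 0ℝ
  ages≼0 []          = ≼-refl
  ages≼0 (x≼0 ∷ M≼0) = ≼-trans (+-mono-≼ x≼0 (ages≼0 M≼0)) +-identityˡ-≼

  ∣∣at-# : ∀ M p → ∣ M ∣at p ≡ places M # p
  ∣∣at-# []            p = refl
  ∣∣at-# ((q , _) ∷ M) p with q ≟ p
  ... | yes _ = cong suc (∣∣at-# M p)
  ... | no _  = ∣∣at-# M p

  unitCost : (∀ p → costP p ≡ 1) → ∀ M →
             sum (map (λ p → ∣ M ∣at p ℕ.* costP p) (allFin nP)) ≡ length M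
  unitCost costP≡1 M = begin
    sum (map (λ p → ∣ M ∣at p ℕ.* costP p) (allFin nP))
      ≡⟨ cong sum (Listₚ.map-cong (λ p → trans (cong₂ ℕ._*_ (∣∣at-# M p) (costP≡1 p)) (ℕₚ.*-identityʳ _)) (allFin nP)) ⟩
    sum (map (places M #_) (allFin nP)) ≡⟨ sum-allFin (places M #_) ⟩
    _                                              ≡⟨ ∑-# (places M) ⟩
    length (places M)                              ≡⟨ Listₚ.length-map proj₁ M ⟩
    length M                                       ∎
    where open ≡-Reasoning

  Matches : Token → Fin nP × Intrv → Set
  Matches (p , x , _) (p′ , 𝓘) = p ≡ p′ × x ∈ᴵ 𝓘

  Match-# : ∀ M α → Match M α → ∀ p → places M # p ≡ map proj₁ α # p
  Match-# M α (π , m) = #-bijection proj₁ proj₁ M α π (proj₁ ∘ m)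

  Match-[] : ∀ M → Match M [] → M ≡ []
  Match-[] []      _       = refl
  Match-[] (_ ∷ _) (π , _) with () ← ↔⇒≡ π

  Match-[-] : ∀ M a → Match M (a ∷ []) → ∃[ tok ] M ≡ tok ∷ [] × Matches tok a
  Match-[-] []          _ (π , _) with () ← ↔⇒≡ π
  Match-[-] (tok ∷ [])  _ (π , m) with Inverse.to π zero | m zero
  ... | zero | tok~a = tok , refl , tok~a
  Match-[-] (_ ∷ _ ∷ _) _ (π , _) with () ← ↔⇒≡ π

  Match-All : ∀ {P : Token → Set} M α → All (λ a → ∀ {tok} → Matches tok a → P tok) α → Match M α → All P M
  Match-All {P} M α all (π , m) = fromLookup M λ i → All.lookup all (∈-lookup (Inverse.to π i)) (m i)
    where
    fromLookup : ∀ M → (∀ i → P (List.lookup M i)) → All P M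
    fromLookup []      _ = []
    fromLookup (_ ∷ M) p = p zero ∷ fromLookup M (p ∘ suc)

  Pointwise⇒Match : ∀ {M α} → Pointwise Matches M α → Match M α
  Pointwise⇒Match M~α =
    mk↔ₛ′ (Fin.cast eq) (Fin.cast (sym eq)) (Finₚ.cast-involutive eq (sym eq)) (Finₚ.cast-involutive (sym eq) eq)
    , Pointwise.lookup⁺ M~α
    where eq = Pointwise.Pointwise-length M~α

-- The net of a counter machine

data Op (R : ℕ) : Set where
  inc dec zero? : Fin R → Op R

-- Pointwise, because register valuations are functions. `dec` is `inc` read backwards and is
-- thereby blocked on a register that is 0.
Effect : ∀ {R} → Op R → (ρ ρ′ : Fin R → ℕ) → Set
Effect (inc r)   ρ ρ′ = ∀ j → ρ′ j ≡ δ r j ℕ.+ ρ j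
Effect (dec r)   ρ ρ′ = ∀ j → ρ j ≡ δ r j ℕ.+ ρ′ j
Effect (zero? r) ρ ρ′ = ρ r ≡ 0 × (∀ j → ρ′ j ≡ ρ j)

record CounterMachine : Set where
  field
    states edges regs : ℕ
    src tgt           : Fin edges → Fin states
    op                : Fin edges → Op regs
    start accept      : Fin states

  MConfig : Set
  MConfig = Fin states × (Fin regs → ℕ)

  data MStep : MConfig → MConfig → Set where
    step : ∀ e {ρ ρ′} → Effect (op e) ρ ρ′ → MStep (src e , ρ) (tgt e , ρ′)

  MRun : MConfig → MConfig → Set
  MRun = Star MStep

module Net (𝓜 : CounterMachine) (load : List (Fin (CounterMachine.regs 𝓜))) where
  open CounterMachine 𝓜

  -- The clock runs in `wait e`, refunds are collected in `work e`. Both depend on the edge, so that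
  -- two edges with equal data still yield different transitions.
  data Ctrl : Set where
    init      : Ctrl
    norm      : Fin states → Ctrl
    wait work : Fin edges → Ctrl

  states′ : ℕ
  states′ = suc (states ℕ.+ (edges ℕ.+ edges))

  encodeCtrl : Ctrl → Fin states′
  encodeCtrl init     = zero
  encodeCtrl (norm s) = suc (s ↑ˡ (edges ℕ.+ edges))
  encodeCtrl (wait e) = suc (states ↑ʳ (e ↑ˡ edges))
  encodeCtrl (work e) = suc (states ↑ʳ (edges ↑ʳ e))

  decodeCtrl : Fin states′ → Ctrl
  decodeCtrl zero    = init
  decodeCtrl (suc i) = [ norm , [ wait , work ]′ ∘ splitAt edges ]′ (splitAt states i)

  decode-encode : ∀ c → decodeCtrl (encodeCtrl c) ≡ c
  decode-encode init     = refl
  decode-encode (norm s) rewrite Finₚ.splitAt-↑ˡ states s (edges ℕ.+ edges) = refl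
  decode-encode (wait e) rewrite Finₚ.splitAt-↑ʳ states (edges ℕ.+ edges) (e ↑ˡ edges)
                               | Finₚ.splitAt-↑ˡ edges e edges = refl
  decode-encode (work e) rewrite Finₚ.splitAt-↑ʳ states (edges ℕ.+ edges) (edges ↑ʳ e)
                               | Finₚ.splitAt-↑ʳ edges edges e = refl

  encodeCtrl-injective : ∀ {c d} → encodeCtrl c ≡ encodeCtrl d → c ≡ d
  encodeCtrl-injective {c} {d} eq =
    trans (sym (decode-encode c)) (trans (cong decodeCtrl eq) (decode-encode d))

  data Trans : Set where
    loading         : Trans
    enter mid exit  : Fin edges → Trans
    credit          : Fin edges → Fin regs → Trans

  from to : Trans → Ctrl
  from loading      = init
  from (enter e)    = norm (src e)
  from (mid e)      = wait e
  from (exit e)     = work e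
  from (credit e r) = work e
  to loading      = norm start
  to (enter e)    = wait e
  to (mid e)      = work e
  to (exit e)     = norm (tgt e)
  to (credit e r) = work e

  Place : Set
  Place = Fin (suc regs)

  clock : Place
  clock = zero

  Arc : Set
  Arc = Place × Intrv

  fresh aged any : Place → Arc
  fresh p = p , closed 0 , closed 0
  aged  p = p , closed 1 , ∞
  any   p = p , closed 0 , ∞

  inputs outputs : Op regs → List Arc
  inputs (dec r)  = any (suc r) ∷ []
  inputs _        = []
  outputs (inc r) = fresh (suc r) ∷ []
  outputs _       = []

  input output : Trans → List Arc
  input (mid e)      = aged clock ∷ []
  input (exit e)     = inputs (op e)
  input (credit e r) = aged (suc r) ∷ []
  input _            = []
  output loading      = map (fresh ∘ suc) load
  output (enter e)    = fresh clock ∷ []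
  output (mid e)      = []
  output (exit e)     = outputs (op e)
  output (credit e r) = fresh (suc r) ∷ []

  -- The place under test earns no refund, which penalises a false zero test.
  refundable : Op regs → Place → Bool
  refundable _         zero    = true
  refundable (zero? r) (suc j) = not (does (r ≟ j))
  refundable _         (suc _) = true

  refund : Bool → ℤ
  refund true  = -[1+ 0 ]
  refund false = ℤ.+ 0

  transCost : Trans → ℤ
  -- The clock token ages too, so its own unit has to be refunded.
  transCost (mid e)      = refund true
  transCost (credit e r) = refund (refundable (op e) (suc r))
  transCost _            = ℤ.+ 0

  transitionOf : Trans → Transition states′ (suc regs)
  transitionOf t = record
    { source = encodeCtrl (from t)
    ; target = encodeCtrl (to t)
    ; In     = input t
    ; Read   = []
    ; Out    = output t
    }

  -- Control-states separate all transitions except the credits of one edge, and these differ in the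
  -- place from which they consume.
  transitionOf-injective : ∀ t u → transitionOf t ≈ᵗ transitionOf u → t ≡ u
  transitionOf-injective t u t≈u =
    go t u (encodeCtrl-injective source-≡) (encodeCtrl-injective target-≡)
      (λ inputs → Permₚ.↭-singleton-inv (subst (_ Perm.↭_) inputs In-↭))
    where
    open _≈ᵗ_ t≈u
    go : ∀ t u → from t ≡ from u → to t ≡ to u →
         (∀ {a} → input u ≡ a ∷ [] → input t ≡ a ∷ []) → t ≡ u
    go loading      loading      _    _    _ = refl
    go (enter e)    (enter e)    _    refl _ = refl
    go (mid e)      (mid e)      refl _    _ = refl
    go (exit e)     (exit e)     refl _    _ = refl
    go (credit e r) (credit e s) refl _    same with refl ← same refl = refl
    go loading      (enter _)    ()   _    _
    go loading      (mid _)      ()   _    _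
    go loading      (exit _)     ()   _    _
    go loading      (credit _ _) ()   _    _
    go (enter _)    loading      ()   _    _
    go (enter _)    (mid _)      ()   _    _
    go (enter _)    (exit _)     ()   _    _
    go (enter _)    (credit _ _) ()   _    _
    go (mid _)      loading      ()   _    _
    go (mid _)      (enter _)    ()   _    _
    go (mid _)      (exit _)     ()   _    _
    go (mid _)      (credit _ _) ()   _    _
    go (exit _)     loading      ()   _    _
    go (exit _)     (enter _)    ()   _    _
    go (exit _)     (mid _)      ()   _    _
    go (exit _)     (credit _ _) _    ()   _
    go (credit _ _) loading      ()   _    _
    go (credit _ _) (enter _)    ()   _    _
    go (credit _ _) (mid _)      ()   _    _
    go (credit _ _) (exit _)     _    ()   _

  kinds : ℕ
  kinds = 3 ℕ.+ regs

  kind : Fin edges → Fin kinds → Trans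
  kind e zero                = enter e
  kind e (suc zero)          = mid e
  kind e (suc (suc zero))    = exit e
  kind e (suc (suc (suc r))) = credit e r

  transes : ℕ
  transes = suc (edges ℕ.* kinds)

  decodeTrans : Fin transes → Trans
  -- Index 0 puts `loading` at the head of the encoded list of transitions, so that the tail of the
  -- code is independent of the load.
  decodeTrans zero    = loading
  decodeTrans (suc i) = uncurry kind (Fin.remQuot kinds i)

  encodeTrans : Trans → Fin transes
  encodeTrans loading      = zero
  encodeTrans (enter e)    = suc (Fin.combine e zero)
  encodeTrans (mid e)      = suc (Fin.combine e (suc zero))
  encodeTrans (exit e)     = suc (Fin.combine e (suc (suc zero)))
  encodeTrans (credit e r) = suc (Fin.combine e (suc (suc (suc r))))

  decode-encodeTrans : ∀ t → decodeTrans (encodeTrans t) ≡ t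
  decode-encodeTrans loading      = refl
  decode-encodeTrans (enter e) = cong (uncurry kind) (Finₚ.remQuot-combine e zero)
  decode-encodeTrans (mid e) = cong (uncurry kind) (Finₚ.remQuot-combine e (suc zero))
  decode-encodeTrans (exit e) = cong (uncurry kind) (Finₚ.remQuot-combine e (suc (suc zero)))
  decode-encodeTrans (credit e r) = cong (uncurry kind) (Finₚ.remQuot-combine e (suc (suc (suc r))))

  encode-decodeTrans : ∀ i → encodeTrans (decodeTrans i) ≡ i
  encode-decodeTrans zero    = refl
  encode-decodeTrans (suc i) = trans (encode-kind _ _) (cong suc (Finₚ.combine-remQuot {edges} kinds i))
    where
    encode-kind : ∀ e k → encodeTrans (kind e k) ≡ suc (Fin.combine e k)
    encode-kind e zero                = refl
    encode-kind e (suc zero)          = refl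
    encode-kind e (suc (suc zero))    = refl
    encode-kind e (suc (suc (suc r))) = refl

  net : PTPN
  net = record
    { nQ         = states′
    ; nP         = suc regs
    ; nT         = transes
    ; transition = transitionOf ∘ decodeTrans
    ; distinct   = λ i j i≈j → trans (sym (encode-decodeTrans i)) (trans
                     (cong encodeTrans (transitionOf-injective (decodeTrans i) (decodeTrans j) i≈j))
                     (encode-decodeTrans j))
    ; costP      = λ _ → 1
    ; costT      = transCost ∘ decodeTrans
    }

  inst : Instance
  inst = record
    { net       = net
    ; q-init    = encodeCtrl init
    ; q-fin     = encodeCtrl (norm accept)
    ; threshold = 0
    }

-- Cheap computations follow runs of the machine

module Soundness (𝓜 : CounterMachine) (load : List (Fin (CounterMachine.regs 𝓜))) where
  open CounterMachine 𝓜
  open Net 𝓜 load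
  open Semantics net
  open Markings net
  open SetoidPerm (×-setoid (setoid Place) ℝ≥0-setoid) using (↭-sym; ↭-refl)
  open SetoidPermₚ (×-setoid (setoid Place) ℝ≥0-setoid) using (Any-resp-↭; All-resp-↭)

  record Firing (t : Trans) (M M′ : Marking) : Set where
    field
      I O K    : Marking
      before   : M ↭ I ++ K
      after    : M′ ↭ O ++ K
      consumed : Match I (input t)
      produced : Match O (output t)

  open Firing

  tokens : List Arc → Place → ℕ
  tokens α p = map proj₁ α # p

  firing-# : ∀ {t M M′} → Firing t M M′ → ∀ p →
             places M′ # p ℕ.+ tokens (input t) p ≡ places M # p ℕ.+ tokens (output t) p
  firing-# {t} {M} {M′} φ p = begin
    places M′ # p ℕ.+ tokens (input t) p
      ≡⟨ cong₂ ℕ._+_ (split (O φ) (K φ) (after φ)) (sym (Match-# (I φ) (input t) (consumed φ) p)) ⟩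
    places (O φ) # p ℕ.+ places (K φ) # p ℕ.+ places (I φ) # p
      ≡⟨ solve 3 (λ o k i → o :+ k :+ i := i :+ k :+ o) refl (places (O φ) # p) (places (K φ) # p) (places (I φ) # p) ⟩
    places (I φ) # p ℕ.+ places (K φ) # p ℕ.+ places (O φ) # p
      ≡⟨ cong₂ ℕ._+_ (sym (split (I φ) (K φ) (before φ))) (Match-# (O φ) (output t) (produced φ) p) ⟩
    places M # p ℕ.+ tokens (output t) p ∎
    where
    open ≡-Reasoning
    open ℕ-Solver
    split : ∀ {N} X Y → N ↭ X ++ Y → places N # p ≡ places X # p ℕ.+ places Y # p
    split X Y N↭ = trans (#-↭ N↭ p)
      (trans (cong (_# p) (Listₚ.map-++ proj₁ X Y)) (#-++ (places X) (places Y) p))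

  places-^+ : ∀ M x → places (M ^+ x) ≡ places M
  places-^+ []      x = refl
  places-^+ (_ ∷ M) x = cong (_ ∷_) (places-^+ M x)

  timed-# : ∀ {M M′ x} → M′ ↭ M ^+ x → ∀ p → places M′ # p ≡ places M # p
  timed-# {M} {x = x} M′↭ p = trans (#-↭ M′↭ p) (cong (_# p) (places-^+ M x))

  clockTokens : Ctrl → ℕ
  clockTokens (wait e) = 1
  clockTokens _        = 0

  -- This rules out a spare clock token from an earlier edge, with which `mid` could fire at once
  -- and the edge would take no time.
  clock-fire : ∀ t {M M′} → Firing t M M′ →
               places M # clock ≡ clockTokens (from t) → places M′ # clock ≡ clockTokens (to t)
  clock-fire t {M} {M′} φ M#≡ = go t (trans (firing-# φ clock) (cong (ℕ._+ _) M#≡))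
    where
    go : ∀ t {m′} → m′ ℕ.+ tokens (input t) clock ≡ clockTokens (from t) ℕ.+ tokens (output t) clock →
         m′ ≡ clockTokens (to t)
    go loading eq = trans (trans (sym (ℕₚ.+-identityʳ _)) eq)
      (trans (cong (_# clock) (sym (Listₚ.map-∘ load))) (#-map-suc-zero load))
    go (enter e) eq = trans (sym (ℕₚ.+-identityʳ _)) eq
    go (mid e)   eq = ℕₚ.+-cancelʳ-≡ 1 _ 0 eq
    go (exit e)  eq with op e
    ... | inc r   = trans (sym (ℕₚ.+-identityʳ _)) eq
    ... | dec r   = trans (sym (ℕₚ.+-identityʳ _)) eq
    ... | zero? r = trans (sym (ℕₚ.+-identityʳ _)) eq
    go (credit e r) eq = trans (sym (ℕₚ.+-identityʳ _)) eq

  -- The amount that `refund` pays back, hence with the opposite sign.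
  wt : Bool → ℝ
  wt true  = fromℕ 1
  wt false = 0ℝ

  wt≼1 : ∀ b → wt b ≼ fromℕ 1
  wt≼1 true  = ≼-refl
  wt≼1 false = 0≼1

  0≼wt : ∀ b → 0ℝ ≼ wt b
  0≼wt true  = 0≼1
  0≼wt false = ≼-refl

  refund-wt : ∀ b x → x ≼ fromℤ (refund b) +ᴿ (wt b +ᴿ x)
  refund-wt true  x = pointwise-≼ λ n →
    trans (sym (ℚₚ.+-identityˡ (seq x n))) (ℚₚ.+-assoc (-[1+ 0 ] ℚ./ 1) (ℤ.+ 1 ℚ./ 1) (seq x n))
  refund-wt false x = ≼-trans +-identityˡ′-≼ +-identityˡ′-≼

  repay : ∀ b {x y} → wt b +ᴿ x ≼ y → x ≼ fromℤ (refund b) +ᴿ y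
  repay b {x} p = ≼-trans (refund-wt b x) (+-mono-≼ ≼-refl p)

  produced-ages : ∀ t {O} → Match O (output t) → ages O ≼ 0ℝ
  produced-ages t {O} m = ages≼0 (Match-All O (output t) (freshArcs t) m)
    where
    Fresh : Arc → Set
    Fresh a = ∀ {tok} → Matches tok a → age tok ≼ 0ℝ
    fresh! : ∀ p → Fresh (fresh p)
    fresh! p (_ , _ , x≤0) = ≤⇒≼ x≤0
    freshArcs : ∀ t → All Fresh (output t)
    freshArcs loading      = Allₚ.map⁺ (All.universal (λ r {tok} → fresh! (suc r) {tok}) load)
    freshArcs (enter e)    = (λ {tok} → fresh! clock {tok}) ∷ []
    freshArcs (mid e)      = []
    freshArcs (exit e) with op e
    ... | inc r   = (λ {tok} → fresh! (suc r) {tok}) ∷ []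
    ... | dec r   = []
    ... | zero? r = []
    freshArcs (credit e r) = (λ {tok} → fresh! (suc r) {tok}) ∷ []

  -- Here c is the loss of the firing: consumed age that is not refunded. Produced tokens have age
  -- 0, so none of the consumed age survives in them.
  firing-ages : ∀ {t M M′ c} (φ : Firing t M M′) → c ≼ fromℤ (transCost t) +ᴿ ages (I φ) →
                c +ᴿ ages M′ ≼ fromℤ (transCost t) +ᴿ ages M
  firing-ages {t} φ c≼ =
    ≼-trans (+-mono-≼ c≼ (≼-trans (ages-↭ (after φ)) (≼-trans (ages-++ (O φ) (K φ))
      (≼-trans (+-mono-≼ (produced-ages t {O φ} (produced φ)) ≼-refl) +-identityˡ-≼))))
    (≼-trans +-assoc-≼ (+-mono-≼ ≼-refl
      (≼-trans (ages-++′ (I φ) (K φ)) (ages-↭ (↭-sym (before φ))))))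

  -- A refund of 1 is paid only for a token of age at least 1, so no firing makes a profit.
  consumed-ages : ∀ t {I} → Match I (input t) → 0ℝ ≼ fromℤ (transCost t) +ᴿ ages I
  consumed-ages loading   {I} m = ≼-trans +-identityˡ′-≼ (+-mono-≼ ≼-refl (0≼ages I))
  consumed-ages (enter e) {I} m = ≼-trans +-identityˡ′-≼ (+-mono-≼ ≼-refl (0≼ages I))
  consumed-ages (mid e)   {I} m with tok , refl , _ , 1≤a , _ ← Match-[-] I _ m =
    repay true (≼-trans +-identityʳ-≼ (≼-trans (≤⇒≼ 1≤a) +-identityʳ′-≼))
  consumed-ages (exit e) {I} m = ≼-trans +-identityˡ′-≼ (+-mono-≼ ≼-refl (0≼ages I))
  consumed-ages (credit e r) {I} m with tok , refl , _ , 1≤a , _ ← Match-[-] I _ m =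
    repay (refundable (op e) (suc r)) (≼-trans +-identityʳ-≼
      (≼-trans (wt≼1 (refundable (op e) (suc r))) (≼-trans (≤⇒≼ 1≤a) +-identityʳ′-≼)))

  timed-ages : ∀ {M M′} (x : ℝ≥0) → M′ ↭ M ^+ x →
               ages M′ ≼ _·_ (length M) (proj₁ x) +ᴿ ages M
  timed-ages {M} x M′↭ = ≼-trans (ages-↭ M′↭) (pointwise-≼ (ages-^+-≡ M x))

  timed-cost : ∀ M x {y} → y ≼ (length M · x) +ᴿ ages M →
               y ≼ (_ · x) +ᴿ ages M
  timed-cost M x {y} = subst (λ k → y ≼ (k · x) +ᴿ ages M) (sym (unitCost (λ _ → refl) M))

  Older : (Place → ℝ) → Token → Set
  Older f tok = f (proj₁ tok) ≼ age tok

  Any-↭ : ∀ f {M N} → M ↭ N → Any (Older f) M → Any (Older f) N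
  Any-↭ f = Any-resp-↭ λ { {_ , x} {_ , y} (refl , x≃y) fp≼x → ≼-trans fp≼x (≈⇒≼ {x} {y} x≃y) }

  debt : Fin edges → Place → ℝ
  debt e p = wt (refundable (op e) p)

  ClockBelow : ℝ → Token → Set
  ClockBelow s tok = proj₁ tok ≡ clock → age tok ≼ s

  ClockBelow-↭ : ∀ s {M N} → M ↭ N → All (ClockBelow s) M → All (ClockBelow s) N
  ClockBelow-↭ s = All-resp-↭ λ { {_ , x} {_ , y} (refl , x≃y) below eq →
    ≼-trans (≃⇒≼ (proj₁ y) (proj₁ x) (≃-sym {proj₁ x} {proj₁ y} x≃y)) (below eq) }

  -- After a false zero test some token is older by 1 than the refunds still to come
  -- on the current edge; s bounds the age of the running clock.
  Cheated : Ctrl → Marking → Set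
  Cheated init     M = ⊥
  Cheated (norm s) M = Any (Older λ _ → fromℕ 1) M
  Cheated (wait e) M = ∃[ s ] All (ClockBelow s) M × Any (Older λ p → debt e p +ᴿ s) M
  Cheated (work e) M = Any (Older λ p → debt e p +ᴿ fromℕ 1) M

  1≼debt+1 : ∀ e p → fromℕ 1 ≼ debt e p +ᴿ fromℕ 1
  1≼debt+1 e p = ≼-trans +-identityˡ′-≼ (+-mono-≼ (0≼wt (refundable (op e) p)) ≼-refl)

  ^+-Any : ∀ {f x M} → Any (Older f) M → Any (Older λ p → f p +ᴿ proj₁ x) (M ^+ x)
  ^+-Any = Anyₚ.map⁺ ∘ Any.map λ fp≼a → +-mono-≼ fp≼a ≼-refl

  ≼+ : ∀ {x y} → 0ℝ ≼ y → x ≼ x +ᴿ y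
  ≼+ 0≼y = ≼-trans +-identityʳ′-≼ (+-mono-≼ ≼-refl 0≼y)

  cheated-timed : ∀ c {M M′} (x : ℝ≥0) → M′ ↭ M ^+ x → Cheated c M → Cheated c M′
  cheated-timed (norm s) x M′↭ old =
    Any-↭ _ (↭-sym M′↭) (Any.map (≼-trans (≼+ (≤⇒≼ (proj₂ x)))) (^+-Any {x = x} old))
  -- The clock and the old token age together, so the bound s moves by the same delay.
  cheated-timed (wait e) x M′↭ (s , below , old) =
    s +ᴿ proj₁ x
    , ClockBelow-↭ _ (↭-sym M′↭) (Allₚ.map⁺ (All.map (λ b eq → +-mono-≼ (b eq) ≼-refl) below))
    , Any-↭ _ (↭-sym M′↭) (Any.map (≼-trans +-assoc′-≼) (^+-Any {x = x} old))
  cheated-timed (work e) x M′↭ old =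
    Any-↭ _ (↭-sym M′↭) (Any.map (≼-trans (≼+ (≤⇒≼ (proj₂ x)))) (^+-Any {x = x} old))

  noClock : ∀ {s} K → places K # clock ≡ 0 → All (ClockBelow s) K
  noClock []                _  = []
  noClock ((zero  , _) ∷ K) ()
  noClock ((suc r , _) ∷ K) eq = (λ ()) ∷ noClock K eq

  Any-before : ∀ f {t M M′} (φ : Firing t M M′) → Any (Older f) M → Any (Older f) (I φ) ⊎ Any (Older f) (K φ)
  Any-before f φ old = Anyₚ.++⁻ (I φ) (Any-↭ f (before φ) old)

  Any-after : ∀ f {t M M′} (φ : Firing t M M′) → Any (Older f) (K φ) → Any (Older f) M′
  Any-after f φ old = Any-↭ f (↭-sym (after φ)) (Anyₚ.++⁺ʳ (O φ) old)

  start-wait : ∀ e {M M′} (φ : Firing (enter e) M M′) → places M # clock ≡ 0 → All (ClockBelow 0ℝ) M′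
  start-wait e {M} φ M#≡0 = ClockBelow-↭ _ (↭-sym (after φ)) (Allₚ.++⁺
    (Match-All {P = ClockBelow 0ℝ} (O φ) (output (enter e)) ((λ { (_ , _ , x≤0) _ → ≤⇒≼ x≤0 }) ∷ []) (produced φ))
    (noClock (K φ) (trans (sym K#≡) M#≡0)))
    where
    K#≡ : places M # clock ≡ places (K φ) # clock
    K#≡ = trans (#-↭ (before φ) clock)
      (cong (λ I → places (I ++ K φ) # clock) (Match-[] (I φ) (consumed φ)))

  -- The old token either stays among the untouched tokens and preserves the invariant, or it is the
  -- consumed one; then its age exceeds the refund by at least 1, and the loss is realised in this
  -- firing.
  cheated-fire : ∀ t {M M′} (φ : Firing t M M′) → places M # clock ≡ clockTokens (from t) →
                 Cheated (from t) M →
                 Cheated (to t) M′ ⊎ fromℕ 1 ≼ fromℤ (transCost t) +ᴿ ages (I φ)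
  cheated-fire (enter e) φ M#≡0 old with Any-before _ φ old
  ... | inj₁ i rewrite Match-[] (I φ) (consumed φ) with () ← i
  -- The leftover age 1 covers any refund on the new edge, and the new clock starts at age 0.
  ... | inj₂ k = inj₁ (0ℝ , start-wait e φ M#≡0 , Any-after _ φ
          (Any.map (λ {tok} → ≼-trans (≼-trans +-identityʳ-≼ (wt≼1 (refundable (op e) (proj₁ tok))))) k))
  cheated-fire (mid e) φ@record { K = K ; before = b ; consumed = m } _ (s , below , old)
    with (_ , x , 0≤x) , refl , refl , 1≤x , _ ← Match-[-] (I φ) _ m
    with x≼s ← All.head (ClockBelow-↭ s b below) refl | Any-before _ φ old
  -- The old token is the clock itself. From `1 ≤ x ≤ s` and `1 + s ≤ x` its age is at least 2, of
  -- which only 1 is refunded.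
  ... | inj₁ (here 1+s≼x) = inj₂ (repay true (≼-trans
          (+-mono-≼ ≼-refl (≼-trans (≤⇒≼ 1≤x) x≼s)) (≼-trans 1+s≼x +-identityʳ′-≼)))
  ... | inj₂ k = inj₁ (Any-after _ φ (Any.map (≼-trans (+-mono-≼ ≼-refl (≼-trans (≤⇒≼ 1≤x) x≼s))) k))
  cheated-fire (exit e) φ _ old with Any-before _ φ old
  ... | inj₁ i = inj₂ (≼-trans (age≼ages (Any.map (λ {tok} → ≼-trans (1≼debt+1 e (proj₁ tok))) i)) +-identityˡ′-≼)
  ... | inj₂ k = inj₁ (Any-after _ φ (Any.map (λ {tok} → ≼-trans (1≼debt+1 e (proj₁ tok))) k))
  cheated-fire (credit e r) φ@record { consumed = m } _ old
    with (_ , x , 0≤x) , refl , refl , _ ← Match-[-] (I φ) _ m | Any-before _ φ old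
  ... | inj₁ (here d+1≼x) = inj₂ (repay (refundable (op e) (suc r)) (≼-trans d+1≼x +-identityʳ′-≼))
  ... | inj₂ k            = inj₁ (Any-after _ φ k)

  Guard : Op regs → (Fin regs → ℕ) → Set
  Guard (zero? r) ρ = ρ r ≡ 0
  Guard _         ρ = ⊤

  guard? : ∀ o ρ → Guard o ρ ⊎ ∃[ r ] o ≡ zero? r × ρ r ≢ 0
  guard? (inc r)   ρ = inj₁ tt
  guard? (dec r)   ρ = inj₁ tt
  guard? (zero? r) ρ with ρ r ℕ.≟ 0
  ... | yes ≡0 = inj₁ ≡0
  ... | no  ≢0 = inj₂ (r , refl , ≢0)

  Counts : Marking → (Fin regs → ℕ) → Set
  Counts M ρ = ∀ r → places M # suc r ≡ ρ r

  Reachable : Fin states → (Fin regs → ℕ) → Set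
  Reachable s ρ = MRun (start , load #_) (s , ρ)

  -- A zero test is judged on entering the edge. The counts do not change before `exit`, so the
  -- verdict is carried along until the machine step is made.
  Honest : Ctrl → Marking → Set
  Honest init     M = Counts M (λ _ → 0)
  Honest (norm s) M = ∃[ ρ ] Reachable s ρ × Counts M ρ
  Honest (wait e) M = ∃[ ρ ] Reachable (src e) ρ × Counts M ρ × Guard (op e) ρ
  Honest (work e) M = ∃[ ρ ] Reachable (src e) ρ × Counts M ρ × Guard (op e) ρ

  honest-timed : ∀ c {M M′ x} → M′ ↭ M ^+ x → Honest c M → Honest c M′
  honest-timed init     M′↭ cnt                = λ r → trans (timed-# M′↭ (suc r)) (cnt r)
  honest-timed (norm s) M′↭ (ρ , run , cnt)     = ρ , run , λ r → trans (timed-# M′↭ (suc r)) (cnt r)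
  honest-timed (wait e) M′↭ (ρ , run , cnt , g) = ρ , run , (λ r → trans (timed-# M′↭ (suc r)) (cnt r)) , g
  honest-timed (work e) M′↭ (ρ , run , cnt , g) = ρ , run , (λ r → trans (timed-# M′↭ (suc r)) (cnt r)) , g

  exit-effect : ∀ e {ρ ρ′} → Guard (op e) ρ →
                (∀ j → ρ′ j ℕ.+ tokens (input (exit e)) (suc j) ≡ ρ j ℕ.+ tokens (output (exit e)) (suc j)) →
                Effect (op e) ρ ρ′
  exit-effect e {ρ} {ρ′} g eq with op e
  ... | inc r   = λ j → trans (trans (sym (ℕₚ.+-identityʳ (ρ′ j))) (eq j))
                    (trans (cong (ρ j ℕ.+_) (ℕₚ.+-identityʳ (δ r j))) (ℕₚ.+-comm (ρ j) _))
  ... | dec r   = λ j → trans (trans (sym (ℕₚ.+-identityʳ (ρ j))) (sym (eq j)))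
                    (trans (cong (ρ′ j ℕ.+_) (ℕₚ.+-identityʳ (δ r j))) (ℕₚ.+-comm (ρ′ j) _))
  ... | zero? r = g , λ j → ℕₚ.+-cancelʳ-≡ 0 _ _ (eq j)

  -- The tested place has debt 0, so a token of any age there, even 0, is old enough for `Cheated`
  -- at the moment of entry.
  tested : ∀ e {r M} → op e ≡ zero? r → places M # suc r ≢ 0 → Any (Older λ p → debt e p +ᴿ 0ℝ) M
  tested e {r} {M} op≡ M#≢0 = Any.map (λ {tok} → due {tok}) (Anyₚ.map⁻ (#≢0⇒∈ (places M) M#≢0))
    where
    due : ∀ {tok} → suc r ≡ proj₁ tok → Older (λ p → debt e p +ᴿ 0ℝ) tok
    due {_ , _ , 0≤x} refl rewrite op≡ | dec-true (r ≟ r) refl = ≼-trans +-identityˡ-≼ (≤⇒≼ 0≤x)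

  honest-fire : ∀ t {M M′} → Firing t M M′ → places M # clock ≡ clockTokens (from t) →
                Honest (from t) M → Honest (to t) M′ ⊎ Cheated (to t) M′
  honest-fire loading {M} {M′} φ _ cnt = inj₁ ((load #_) , Star.ε , λ r → begin
    places M′ # suc r                       ≡⟨ ℕₚ.+-identityʳ _ ⟨
    places M′ # suc r ℕ.+ 0                 ≡⟨ firing-# φ (suc r) ⟩
    places M # suc r ℕ.+ tokens (output loading) (suc r)
                                            ≡⟨ cong (ℕ._+ _) (cnt r) ⟩
    tokens (output loading) (suc r)         ≡⟨ cong (_# suc r) (Listₚ.map-∘ load) ⟨
    map Fin.suc load # suc r                ≡⟨ #-map-suc load r ⟩
    load # r                                ∎)
    where open ≡-Reasoning
  honest-fire (enter e) {M} {M′} φ M#≡0 (ρ , run , cnt) with guard? (op e) ρ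
  ... | inj₁ g = inj₁ (ρ , run , (λ r → trans (ℕₚ.+-cancelʳ-≡ 0 _ _ (firing-# φ (suc r))) (cnt r)) , g)
  ... | inj₂ (r , op≡ , ρr≢0) with Any-before _ φ (tested e op≡ (ρr≢0 ∘ trans (sym (cnt r))))
  ...   | inj₁ i rewrite Match-[] (I φ) (consumed φ) with () ← i
  ...   | inj₂ k = inj₂ (0ℝ , start-wait e φ M#≡0 , Any-after _ φ k)
  honest-fire (mid e) φ _ (ρ , run , cnt , g) =
    inj₁ (ρ , run , (λ r → trans (ℕₚ.+-cancelʳ-≡ 0 _ _ (firing-# φ (suc r))) (cnt r)) , g)
  honest-fire (exit e) {M} {M′} φ _ (ρ , run , cnt , g) = inj₁
    ( (λ j → places M′ # suc j)
    , run ◅◅ step e (exit-effect e g λ j → trans (firing-# φ (suc j)) (cong (ℕ._+ _) (cnt j))) ◅ Star.ε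
    , λ r → refl )
  honest-fire (credit e s) φ _ (ρ , run , cnt , g) =
    inj₁ (ρ , run , (λ r → trans (ℕₚ.+-cancelʳ-≡ (tokens (input (credit e s)) (suc r)) _ _ (firing-# φ (suc r))) (cnt r)) , g)

  firing : ∀ i {R M M′} I O K → M ↭ I ++ R ++ K → Match I (input (decodeTrans i)) →
           Match O (output (decodeTrans i)) → M′ ↭ O ++ R ++ K → Firing (decodeTrans i) M M′
  firing i {R} I O K b m p a = record
    { I = I ; O = O ; K = R ++ K ; before = b ; after = a ; consumed = m ; produced = p }

  -- Losses add up along a computation: x and w are the costs of a step and of the rest, z and y the
  -- total ages before and after the step, c and d the two losses.
  chain : ∀ {c d x y z w} → c +ᴿ y ≼ x +ᴿ z → d ≼ w +ᴿ y → c +ᴿ d ≼ (x +ᴿ w) +ᴿ z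
  chain {c} {d} {x} {y} {z} {w} p q =
    ≼-trans (+-mono-≼ ≼-refl (≼-trans q +-comm-≼)) (≼-trans +-assoc′-≼ (≼-trans (+-mono-≼ p ≼-refl)
      (≼-trans +-assoc-≼ (≼-trans (+-mono-≼ ≼-refl +-comm-≼) +-assoc′-≼))))

  chain₀ : ∀ {d x y z w} → y ≼ x +ᴿ z → d ≼ w +ᴿ y → d ≼ (x +ᴿ w) +ᴿ z
  chain₀ p q = ≼-trans +-identityˡ′-≼ (chain (≼-trans +-identityˡ-≼ p) q)

  step-ages : ∀ {q M q′ M′} (s : Step (q , M) (q′ , M′)) → ages M′ ≼ stepCost s +ᴿ ages M
  step-ages (timed {M = M} x _ M′↭) = timed-cost M (proj₁ x) (timed-ages x M′↭)
  step-ages (fire i I R O K _ _ b m _ p a) = ≼-trans +-identityˡ′-≼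
    (firing-ages φ (consumed-ages (decodeTrans i) m))
    where φ = firing i I O K b m p a

  -- After a loss has been realised, this ensures that the remaining computation cannot win it back.
  cost-ages : ∀ {C D} (π : Computation C D) → 0ℝ ≼ cost π +ᴿ ages (proj₂ C)
  cost-ages {_ , M} Star.ε = ≼-trans (0≼ages M) +-identityˡ′-≼
  cost-ages (s ◅ π)   = chain₀ (step-ages s) (cost-ages π)

  Final : Config → Set
  Final C = proj₁ C ≡ encodeCtrl (norm accept)

  cheated-cost : ∀ c {q M D} (π : Computation (q , M) D) → Final D → q ≡ encodeCtrl c →
                 places M # clock ≡ clockTokens c → Cheated c M → fromℕ 1 ≼ cost π +ᴿ ages M
  cheated-cost c Star.ε final q≡ _ ch
    with refl ← encodeCtrl-injective {c} {norm accept} (trans (sym q≡) final) =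
    -- The excess has not been cashed in: it is still part of the final age, which nobody refunds.
    ≼-trans (age≼ages ch) +-identityˡ′-≼
  cheated-cost c (s@(timed {M = M} x _ M′↭) ◅ π) final q≡ clk ch =
    chain₀ (step-ages s) (cheated-cost c π final q≡ (trans (timed-# M′↭ clock) clk) (cheated-timed c x M′↭ ch))
  cheated-cost c (s@(fire i I R O K q₁≡ q₂≡ b m _ p a) ◅ π) final q≡ clk ch
    with φ ← firing i I O K b m p a
    with refl ← encodeCtrl-injective {c} {from (decodeTrans i)} (trans (sym q≡) q₁≡)
    with cheated-fire (decodeTrans i) φ clk ch
  ... | inj₁ ch′  = chain₀ (step-ages s) (cheated-cost _ π final q₂≡ (clock-fire _ φ clk) ch′)
  ... | inj₂ paid = ≼-trans +-identityʳ′-≼ (chain (firing-ages φ paid) (cost-ages π))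

  honest-cost : (∀ ρ → ¬ Reachable accept ρ) →
                ∀ c {q M D} (π : Computation (q , M) D) → Final D → q ≡ encodeCtrl c →
                places M # clock ≡ clockTokens c → Honest c M → fromℕ 1 ≼ cost π +ᴿ ages M
  honest-cost never c Star.ε final q≡ _ h
    with refl ← encodeCtrl-injective {c} {norm accept} (trans (sym q≡) final) =
    contradiction (proj₁ (proj₂ h)) (never (proj₁ h))
  honest-cost never c (s@(timed x _ M′↭) ◅ π) final q≡ clk h =
    chain₀ (step-ages s) (honest-cost never c π final q≡ (trans (timed-# M′↭ clock) clk) (honest-timed c {x = x} M′↭ h))
  honest-cost never c (s@(fire i I R O K q₁≡ q₂≡ b m _ p a) ◅ π) final q≡ clk h
    with φ ← firing i I O K b m p a
    with refl ← encodeCtrl-injective {c} {from (decodeTrans i)} (trans (sym q≡) q₁≡)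
    with honest-fire (decodeTrans i) φ clk h
  ... | inj₁ h′ = chain₀ (step-ages s) (honest-cost never _ π final q₂≡ (clock-fire _ φ clk) h′)
  ... | inj₂ ch = chain₀ (step-ages s) (cheated-cost _ π final q₂≡ (clock-fire _ φ clk) ch)

  sound : (∀ ρ → ¬ Reachable accept ρ) → ¬ CostThreshold inst
  -- Any rational strictly between the threshold 0 and the lower bound 1 would do.
  sound never cheap with cheap ½ 0ℝ<½
  ... | c , (D , final , π , refl) , c<½ =
    1≼⇒≮½ (cost π) (≼-trans (honest-cost never init π final refl refl λ _ → refl) +-identityʳ-≼) c<½

-- Runs of the machine give cheap computations

module Completeness (𝓜 : CounterMachine) (load : List (Fin (CounterMachine.regs 𝓜))) where
  open CounterMachine 𝓜
  open Net 𝓜 load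
  open Semantics net
  open Markings net
  open SetoidPerm (×-setoid (setoid Place) ℝ≥0-setoid) using (↭-sym; ↭-refl; ↭-reflexive)
  open SetoidPermₚ (×-setoid (setoid Place) ℝ≥0-setoid) using (↭-shift)

  -- Every token keeps its age in credit, so an honest run costs nothing once all ages are refunded.
  Balanced : Config → Config → Set
  Balanced C D = Σ[ π ∈ Computation C D ] cost π +ᴿ ages (proj₂ C) ≼ ages (proj₂ D)

  cost-◅◅ : ∀ {C D E} (π : Computation C D) (ρ : Computation D E) → cost (π ◅◅ ρ) ≼ cost π +ᴿ cost ρ
  cost-◅◅ Star.ε       ρ = +-identityˡ′-≼
  cost-◅◅ (s ◅ π) ρ = ≼-trans (+-mono-≼ ≼-refl (cost-◅◅ π ρ)) +-assoc′-≼

  infixr 5 _▷_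

  _▷_ : ∀ {C D E} → Balanced C D → Balanced D E → Balanced C E
  (π , p) ▷ (ρ , q) = π ◅◅ ρ
    , ≼-trans (+-mono-≼ (≼-trans (cost-◅◅ π ρ) +-comm-≼) ≼-refl)
        (≼-trans +-assoc-≼ (≼-trans (+-mono-≼ ≼-refl p) q))

  0≤0 : 0ℝ ≤ᴿ 0ℝ
  0≤0 = ≼⇒≤ (≼-refl {0ℝ})

  0⁰ 1⁰ : ℝ≥0
  0⁰ = 0ℝ , 0≤0
  1⁰ = fromℕ 1 , ≼⇒≤ 0≼1

  fireBalanced : ∀ t {M M′} I O K → M ↭ I ++ K → M′ ↭ O ++ K → Match I (input t) → Match O (output t) →
                 fromℤ (transCost t) +ᴿ ages I ≼ ages O →
                 Balanced (encodeCtrl (from t) , M) (encodeCtrl (to t) , M′)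
  fireBalanced t {M} {M′} I O K b a m p c = go (encodeTrans t) (decode-encodeTrans t)
    where
    -- The index is generalised so that t can be replaced by `decodeTrans i`; then the net's
    -- transition at i is the desired one without transport.
    go : ∀ i → decodeTrans i ≡ t → Balanced (encodeCtrl (from t) , M) (encodeCtrl (to t) , M′)
    go i refl = fire i I [] O K refl refl b m (noRead , λ ()) p a ◅ Star.ε
      , ≼-trans (+-mono-≼ +-identityʳ-≼ (≼-trans (ages-↭ b) (ages-++ I K)))
        (≼-trans +-assoc′-≼ (≼-trans (+-mono-≼ c ≼-refl) (≼-trans (ages-++′ O K) (ages-↭ (↭-sym a)))))
      where
      noRead = proj₁ (Pointwise⇒Match {M = []} {α = []} [])

  timedBalanced : ∀ {q M M′} (x : ℝ≥0) → 0ℝ <ᴿ proj₁ x → M′ ↭ M ^+ x → Balanced (q , M) (q , M′)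
  timedBalanced {q} {M} {M′} x 0<x M′↭ = timed x 0<x M′↭ ◅ Star.ε
    , ≼-trans (+-mono-≼ +-identityʳ-≼ ≼-refl) (subst (λ k → (k · proj₁ x) +ᴿ ages M ≼ ages M′) (sym (unitCost (λ _ → refl) M))
        (≼-trans (pointwise-≼ λ n → sym (ages-^+-≡ M x n)) (ages-↭ (↭-sym M′↭))))

  -- The age of a fresh token after one unit, kept in the form that `_^+_` produces so that the
  -- delayed marking is again given by `marking`.
  1′ : ℝ≥0
  1′ = 0⁰ +⁰ 1⁰

  marking : ℝ≥0 → List (Fin regs) → Marking
  marking a = map λ r → suc r , a

  match₁ : ∀ {tok a} → Matches tok a → Match (tok ∷ []) (a ∷ [])
  match₁ m = Pointwise⇒Match (m ∷ [])

  match₀ : Match [] []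
  match₀ = Pointwise⇒Match []

  fresh-0 : ∀ p → Matches (p , 0⁰) (fresh p)
  fresh-0 p = refl , 0≤0 , 0≤0

  aged-1 : ∀ p → Matches (p , 1′) (aged p)
  aged-1 p = refl , ≼⇒≤ (+-identityˡ′-≼ {fromℕ 1}) , tt

  any-0 : ∀ p → Matches (p , 0⁰) (any p)
  any-0 p = refl , 0≤0 , tt

  refunded : ∀ {b} → b ≡ true → ∀ p → fromℤ (refund b) +ᴿ ages ((p , 1′) ∷ []) ≼ 0ℝ
  refunded refl p = pointwise-≼ λ n → refl

  -- Each renewed token is pushed onto the accumulator k, which is why the list comes out reversed.
  credits : ∀ e l k → All (λ r → refundable (op e) (suc r) ≡ true) l →
            Balanced (encodeCtrl (work e) , marking 1′ l ++ marking 0⁰ k) (encodeCtrl (work e) , marking 0⁰ (l ʳ++ k))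
  credits e []      k _          = Star.ε , +-identityˡ-≼
  credits e (r ∷ l) k (r≢ ∷ l≢) =
    fireBalanced (credit e r) ((suc r , 1′) ∷ []) ((suc r , 0⁰) ∷ []) (marking 1′ l ++ marking 0⁰ k)
      ↭-refl (↭-shift (marking 1′ l) (marking 0⁰ k)) (match₁ (aged-1 (suc r))) (match₁ (fresh-0 (suc r)))
      (≼-trans (refunded r≢ (suc r)) +-identityˡ′-≼)
    ▷ credits e l (r ∷ k) l≢

  traverse : ∀ e l → All (λ r → refundable (op e) (suc r) ≡ true) l →
             Balanced (encodeCtrl (norm (src e)) , marking 0⁰ l) (encodeCtrl (work e) , marking 0⁰ (l ʳ++ []))
  traverse e l r =
    fireBalanced (enter e) [] ((clock , 0⁰) ∷ []) (marking 0⁰ l) ↭-refl ↭-refl match₀ (match₁ (fresh-0 clock)) ≼-refl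
    ▷ timedBalanced {M′ = (clock , 1′) ∷ marking 1′ l} 1⁰ 0ℝ<1 (↭-reflexive (cong (_ ∷_) (Listₚ.map-∘ l)))
    ▷ fireBalanced (mid e) ((clock , 1′) ∷ []) [] (marking 1′ l)
        ↭-refl (↭-reflexive (Listₚ.++-identityʳ _)) (match₁ (aged-1 clock)) match₀ (refunded refl clock)
    ▷ credits e l [] r

  #-ʳ++ : ∀ {k} (l l′ : List (Fin k)) j → (l ʳ++ l′) # j ≡ l # j ℕ.+ l′ # j
  #-ʳ++ []      l′ j = refl
  #-ʳ++ (i ∷ l) l′ j = trans (#-ʳ++ l (i ∷ l′) j)
    (solve 3 (λ x d y → x :+ (d :+ y) := d :+ x :+ y) refl (l # j) (δ i j) (l′ # j))
    where open ℕ-Solver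

  -- In a true zero test the only place without refunds is empty, so every token present can be
  -- renewed at full refund.
  refundable-untested : ∀ o {ρ ρ′} l → Effect o ρ ρ′ → (∀ j → l # j ≡ ρ j) →
                        All (λ r → refundable o (suc r) ≡ true) l
  refundable-untested (inc r)   l _         _    = All.universal (λ _ → refl) l
  refundable-untested (dec r)   l _         _    = All.universal (λ _ → refl) l
  refundable-untested (zero? r) l (ρr≡0 , _) l≡ρ = All.tabulate λ {j} j∈l →
    cong not (dec-false (r ≟ j) λ { refl → #≡0⇒∉ (trans (l≡ρ r) ρr≡0) j∈l })

  depart : ∀ e {ρ ρ′} m → Effect (op e) ρ ρ′ → (∀ j → m # j ≡ ρ j) →
           ∃[ m′ ] (∀ j → m′ # j ≡ ρ′ j) ×
             Balanced (encodeCtrl (work e) , marking 0⁰ m) (encodeCtrl (norm (tgt e)) , marking 0⁰ m′)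
  depart e {ρ} {ρ′} m eff m≡ρ = go (op e) refl eff
    where
    Result = ∃[ m′ ] (∀ j → m′ # j ≡ ρ′ j) ×
      Balanced (encodeCtrl (work e) , marking 0⁰ m) (encodeCtrl (norm (tgt e)) , marking 0⁰ m′)
    fireExit : ∀ {M} o → op e ≡ o → ∀ I O K → marking 0⁰ m ↭ I ++ K → M ↭ O ++ K →
               Match I (inputs o) → Match O (outputs o) →
               ages I ≼ ages O → Balanced (encodeCtrl (work e) , marking 0⁰ m) (encodeCtrl (norm (tgt e)) , M)
    fireExit o op≡ I O K b a m p c = fireBalanced (exit e) I O K b a
      (subst (Match I) (sym (cong inputs op≡)) m) (subst (Match O) (sym (cong outputs op≡)) p) (≼-trans +-identityˡ-≼ c)
    m#r≢0 : ∀ {r} → Effect (dec r) ρ ρ′ → m # r ≢ 0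
    m#r≢0 {r} eff ≡0 with () ← trans (sym ≡0) (trans (m≡ρ r) (trans (eff r) (cong (ℕ._+ ρ′ r) (δ-refl r))))
    #-shift : ∀ r xs ys j → δ r j ℕ.+ (xs ++ ys) # j ≡ (xs ++ r ∷ ys) # j
    #-shift r xs ys j rewrite #-++ xs ys j | #-++ xs (r ∷ ys) j =
      solve 3 (λ d x y → d :+ (x :+ y) := x :+ (d :+ y)) refl (δ r j) (xs # j) (ys # j)
      where open ℕ-Solver
    go : ∀ o → op e ≡ o → Effect o ρ ρ′ → Result
    go (inc r) op≡ eff = r ∷ m , (λ j → trans (cong (δ r j ℕ.+_) (m≡ρ j)) (sym (eff j)))
      , fireExit (inc r) op≡ [] ((suc r , 0⁰) ∷ []) (marking 0⁰ m) ↭-refl ↭-refl match₀ (match₁ (fresh-0 (suc r)))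
          +-identityˡ′-≼
    go (zero? r) op≡ (_ , eff) = m , (λ j → trans (m≡ρ j) (sym (eff j)))
      , fireExit (zero? r) op≡ [] [] (marking 0⁰ m) ↭-refl ↭-refl match₀ match₀ ≼-refl
    -- The effect forces a token on r. It has just been renewed, so removing it forfeits no age.
    go (dec r) op≡ eff with xs , ys , m≡ ← ∈-∃++ (#≢0⇒∈ m (m#r≢0 {r} eff)) =
      xs ++ ys , (λ j → ℕₚ.+-cancelˡ-≡ (δ r j) _ _ (trans (trans (#-shift r xs ys j) (cong (_# j) (sym m≡))) (trans (m≡ρ j) (eff j))))
      , fireExit (dec r) op≡ ((suc r , 0⁰) ∷ []) [] (marking 0⁰ (xs ++ ys))
          (subst₂ (λ X Y → X ↭ (suc r , 0⁰) ∷ Y) (sym (trans (cong (marking 0⁰) m≡) (Listₚ.map-++ _ xs (r ∷ ys))))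
            (sym (Listₚ.map-++ _ xs ys))
            (↭-shift (marking 0⁰ xs) (marking 0⁰ ys)))
          ↭-refl (match₁ (any-0 (suc r))) match₀ +-identityˡ-≼
  simulate : ∀ {s ρ t ρ′} l → (∀ j → l # j ≡ ρ j) → MRun (s , ρ) (t , ρ′) →
             ∃[ l′ ] Balanced (encodeCtrl (norm s) , marking 0⁰ l) (encodeCtrl (norm t) , marking 0⁰ l′)
  simulate l l≡ρ Star.ε = l , Star.ε , +-identityˡ-≼
  simulate l l≡ρ (step e eff ◅ run) =
    let m , m≡ρ′ , β = depart e (l ʳ++ []) eff
          λ j → trans (#-ʳ++ l [] j) (trans (ℕₚ.+-identityʳ _) (l≡ρ j))
        l′ , γ = simulate m m≡ρ′ run
    in l′ , traverse e l (refundable-untested (op e) l eff l≡ρ) ▷ β ▷ γ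

  ages-marking-0 : ∀ l → ages (marking 0⁰ l) ≼ 0ℝ
  ages-marking-0 l = ages≼0 (Allₚ.map⁺ (All.universal (λ _ → ≼-refl) l))

  loaded : Balanced (encodeCtrl init , []) (encodeCtrl (norm start) , marking 0⁰ load)
  loaded = fireBalanced loading [] (marking 0⁰ load) [] ↭-refl
    (↭-reflexive (sym (Listₚ.++-identityʳ _))) match₀ (Pointwise⇒Match (all-fresh load))
    (≼-trans +-identityˡ-≼ (0≼ages (marking 0⁰ load)))
    where
    all-fresh : ∀ l → Pointwise Matches (marking 0⁰ l) (map (fresh ∘ suc) l)
    all-fresh []      = []
    all-fresh (r ∷ l) = fresh-0 (suc r) ∷ all-fresh l

  complete : ∀ {ρ} → MRun (start , load #_) (accept , ρ) → CostThreshold inst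
  complete run q 0<q =
    let l , β = simulate load (λ _ → refl) run
        π , balanced = loaded ▷ β
    in cost π , (_ , refl , π , refl)
       , ≼-<-trans {y = 0ℝ} {z = fromℚ q} (≼-trans +-identityʳ′-≼ (≼-trans balanced (ages-marking-0 l))) 0<q

-- Compiling recursive functions to programs with loops

infixr 5 _⨾_

data Prog : ℕ → Set where
  inc   : ∀ {d} → Fin d → Prog d
  _⨾_   : ∀ {d} → Prog d → Prog d → Prog d
  loop  : ∀ {d} → Fin d → Prog d → Prog d
  local : ∀ {d} → Prog (suc d) → Prog d

data Exec : ∀ {d} → Prog d → Vec ℕ d → Vec ℕ d → Set where
  inc   : ∀ {d i} {ρ : Vec ℕ d} → Exec (inc i) ρ (updateAt ρ i suc)
  _⨾_   : ∀ {d p q} {ρ σ τ : Vec ℕ d} → Exec p ρ σ → Exec q σ τ → Exec (p ⨾ q) ρ τ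
  stop  : ∀ {d i p} {ρ : Vec ℕ d} → lookup ρ i ≡ 0 → Exec (loop i p) ρ ρ
  again : ∀ {d i p n} {ρ σ τ : Vec ℕ d} → lookup ρ i ≡ suc n →
          Exec p (ρ [ i ]≔ n) σ → Exec (loop i p) σ τ → Exec (loop i p) ρ τ
  -- A local variable has to return to 0, because its register is found there again by the next
  -- round of an enclosing loop.
  local : ∀ {d p} {ρ σ : Vec ℕ d} → Exec p (0 ∷ ρ) (0 ∷ σ) → Exec (local p) ρ σ

private variable
  d m n R : ℕ
  L       : Set

ends-at : ∀ {p : Prog d} {ρ σ τ} → σ ≡ τ → Exec p ρ σ → Exec p ρ τ
ends-at refl e = e

add : Fin d → ℕ → Vec ℕ d → Vec ℕ d
add o k ρ = updateAt ρ o (k +_)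

add-0 : ∀ (o : Fin d) ρ → add o 0 ρ ≡ ρ
add-0 o ρ = Vecₚ.updateAt-id o ρ

add-add : ∀ (o : Fin d) j k ρ → add o j (add o k ρ) ≡ add o (j + k) ρ
add-add o j k ρ = Vecₚ.updateAt-updateAt-local o ρ (sym (ℕₚ.+-assoc j k _))

add-suc : ∀ (o : Fin d) k ρ → add o k (updateAt ρ o suc) ≡ add o (suc k) ρ
add-suc o k ρ = Vecₚ.updateAt-updateAt-local o ρ (ℕₚ.+-suc k _)

add-↑ʳ : ∀ (ys : Vec ℕ m) (o : Fin d) k ρ → add (m ↑ʳ o) k (ys Vec.++ ρ) ≡ ys Vec.++ add o k ρ
add-↑ʳ []       o k ρ = refl
add-↑ʳ (y ∷ ys) o k ρ = cong (y ∷_) (add-↑ʳ ys o k ρ)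

-- The loop variable is a new local, hence 0, and the body is never entered.
skip : Prog d
skip = local (loop zero (inc zero))

skip-exec : ∀ {ρ : Vec ℕ d} → Exec skip ρ ρ
skip-exec = local (stop refl)

clear : Fin d → Prog d
clear i = loop i skip

clear-exec : ∀ (i : Fin d) ρ → Exec (clear i) ρ (ρ [ i ]≔ 0)
clear-exec i ρ = go (lookup ρ i) ρ refl
  where
  go : ∀ n ρ → lookup ρ i ≡ n → Exec (clear i) ρ (ρ [ i ]≔ 0)
  go zero    ρ eq = ends-at (sym (trans (cong (ρ [ i ]≔_) (sym eq)) (Vecₚ.[]≔-lookup ρ i))) (stop eq)
  go (suc n) ρ eq = again eq skip-exec
    (ends-at (Vecₚ.[]≔-idempotent ρ i) (go n (ρ [ i ]≔ n) (Vecₚ.lookup∘update i ρ n)))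

move : Fin d → Prog (suc d)
move o = loop zero (inc (suc o))

move-exec : ∀ (o : Fin d) n ρ → Exec (move o) (n ∷ ρ) (0 ∷ add o n ρ)
move-exec o zero    ρ = ends-at (cong (0 ∷_) (sym (add-0 o ρ))) (stop refl)
move-exec o (suc n) ρ = again refl inc
  (ends-at (cong (0 ∷_) (add-suc o n ρ)) (move-exec o n (updateAt ρ o suc)))

-- The copied variable is drained into the output and a local counter, and refilled from the latter.
copy : Fin d → Fin d → Prog d
copy i o = local (loop (suc i) (inc (suc o) ⨾ inc zero) ⨾ move i)

copy-exec : ∀ {i o : Fin d} ρ → i ≢ o → Exec (copy i o) ρ (add o (lookup ρ i) ρ)
copy-exec {i = i} {o} ρ i≢o = local
  (drain v 0 ρ refl ⨾ ends-at (cong (0 ∷_) restore) (move-exec i (v + 0) (drained v ρ)))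
  where
  v = lookup ρ i
  drained : ℕ → Vec ℕ _ → Vec ℕ _
  drained n ρ = (add o n ρ) [ i ]≔ 0
  drain : ∀ n k ρ → lookup ρ i ≡ n →
          Exec (loop (suc i) (inc (suc o) ⨾ inc zero)) (k ∷ ρ) (n + k ∷ drained n ρ)
  drain zero    k ρ eq = ends-at
    (cong (k ∷_) (sym (trans (cong (_[ i ]≔ 0) (add-0 o ρ)) (trans (cong (ρ [ i ]≔_) (sym eq)) (Vecₚ.[]≔-lookup ρ i))))) (stop eq)
  drain (suc n) k ρ eq = again eq (inc ⨾ inc) (ends-at (cong₂ _∷_ (ℕₚ.+-suc n k)
    (begin
      add o n (updateAt (ρ [ i ]≔ n) o suc) [ i ]≔ 0 ≡⟨ cong (_[ i ]≔ 0) (add-suc o n (ρ [ i ]≔ n)) ⟩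
      add o (suc n) (ρ [ i ]≔ n) [ i ]≔ 0            ≡⟨ cong (_[ i ]≔ 0) (Vecₚ.updateAt-commutes o i (i≢o ∘ sym) ρ) ⟩
      add o (suc n) ρ [ i ]≔ n [ i ]≔ 0              ≡⟨ Vecₚ.[]≔-idempotent _ i ⟩
      add o (suc n) ρ [ i ]≔ 0                       ∎))
    (drain n (suc k) (updateAt (ρ [ i ]≔ n) o suc)
      (trans (Vecₚ.lookup∘updateAt′ i o i≢o (ρ [ i ]≔ n)) (Vecₚ.lookup∘update i ρ n))))
    where open ≡-Reasoning
  restore : add i (v + 0) (drained v ρ) ≡ add o v ρ
  restore = begin
    add i (v + 0) (add o v ρ [ i ]≔ 0) ≡⟨ Vecₚ.updateAt-updateAt i (add o v ρ) ⟩
    add o v ρ [ i ]≔ (v + 0 + 0)       ≡⟨ cong (add o v ρ [ i ]≔_) (trans (ℕₚ.+-identityʳ _)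
                                            (trans (ℕₚ.+-identityʳ v) (sym (Vecₚ.lookup∘updateAt′ i o i≢o ρ)))) ⟩
    add o v ρ [ i ]≔ lookup (add o v ρ) i ≡⟨ Vecₚ.[]≔-lookup _ i ⟩
    add o v ρ                          ∎
    where open ≡-Reasoning

mutual
  -- compile f ins o adds the value of f at the variables ins to the variable o.
  compile : Rec n → (Fin n → Fin d) → Fin d → Prog d
  compile zer         ins o = skip
  compile succ        ins o = copy (ins zero) o ⨾ inc o
  compile (proj i)    ins o = copy (ins i) o
  compile (comp f gs) ins o = evaluating gs ins (compile f (_↑ˡ _) (_ ↑ʳ o))
  -- The locals are a countdown, the accumulator and an index. A loop can only count down, while g
  -- asks for the number of the stage; the index therefore counts up alongside.
  compile (prec f g)  ins o =
    local (copy (suc (ins zero)) zero ⨾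
    local (compile f (accArgs ins) zero ⨾
    local (precLoop g ins ⨾ clear zero) ⨾
    move (suc o)))
  compile (mu f) ins o =
    local (
    local (compile f (muArgs ins) zero ⨾ muLoop f ins) ⨾
    move o)

  precLoop : Rec (2 + n) → (Fin (suc n) → Fin d) → Prog (3 + d)
  precLoop g ins = loop (suc (suc zero))
    (local (compile g (precArgs ins) zero ⨾ clear (suc (suc zero)) ⨾ move (suc zero)) ⨾ inc zero)

  muLoop : Rec (suc n) → (Fin n → Fin d) → Prog (2 + d)
  -- Entering a round has taken 1 from the nonzero result; `clear` discards the rest before f is
  -- tried on the next index.
  muLoop f ins = loop zero (clear zero ⨾ inc (suc zero) ⨾ compile f (muArgs ins) zero)

  -- The first argument becomes the innermost local, so the values occupy the first m variables in
  -- their order when the body runs.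
  evaluating : Vec (Rec n) m → (Fin n → Fin d) → Prog (m + d) → Prog d
  evaluating                   []       ins body = body
  evaluating {m = suc m} (g ∷ gs) ins body =
    evaluating gs ins (local (compile g (λ i → suc (m ↑ʳ ins i)) zero ⨾ body ⨾ clear zero))

  -- Under the locals accumulator and countdown.
  accArgs : (Fin (suc n) → Fin d) → Fin n → Fin (2 + d)
  accArgs ins i = suc (suc (ins (suc i)))

  -- Under the locals result, index, accumulator and countdown.
  precArgs : (Fin (suc n) → Fin d) → Fin (2 + n) → Fin (4 + d)
  precArgs ins zero          = suc zero
  precArgs ins (suc zero)    = suc (suc zero)
  precArgs ins (suc (suc i)) = suc (suc (suc (suc (ins (suc i)))))

  -- Under the locals result and index.
  muArgs : (Fin n → Fin d) → Fin (suc n) → Fin (2 + d)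
  muArgs ins zero    = suc zero
  muArgs ins (suc i) = suc (suc (ins i))

mutual
  compile-exec : ∀ {f : Rec n} {xs y} → f [ xs ]⇓ y → ∀ (ins : Fin n → Fin d) o {ρ} →
                 (∀ i → lookup ρ (ins i) ≡ lookup xs i) → (∀ i → ins i ≢ o) →
                 Exec (compile f ins o) ρ (add o y ρ)
  compile-exec ⇓zer ins o {ρ} inp out = ends-at (sym (add-0 o ρ)) skip-exec
  compile-exec (⇓succ {x}) ins o {ρ} inp out =
    ends-at (cong (λ k → add o k ρ) (inp zero)) (copy-exec ρ (out zero)) ⨾
    ends-at (add-add o 1 x ρ) inc
  compile-exec (⇓proj {i = i}) ins o {ρ} inp out =
    ends-at (cong (λ k → add o k ρ) (inp i)) (copy-exec ρ (out i))
  compile-exec {d = d} (⇓comp {m = m} {ys = ys} {z} gs⇓ f⇓) ins o {ρ} inp out =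
    evaluating-exec gs⇓ ins inp (ends-at (add-↑ʳ ys o z ρ)
      (compile-exec f⇓ (_↑ˡ d) (m ↑ʳ o) (Vecₚ.lookup-++ˡ ys ρ) λ i → ↑ˡ≢↑ʳ i))
    where
    ↑ˡ≢↑ʳ : ∀ {m d} (i : Fin m) {o : Fin d} → i ↑ˡ d ≢ m ↑ʳ o
    ↑ˡ≢↑ʳ (suc i) eq = ↑ˡ≢↑ʳ i (Finₚ.suc-injective eq)
  compile-exec p@(⇓prec0 _)   ins o inp out = prec-exec p ins o inp out
  compile-exec p@(⇓precS _ _) ins o inp out = prec-exec p ins o inp out
  compile-exec (⇓mu {y = y} below f⇓) ins o {ρ} inp out =
    let v , first , rest = muLoop-exec below f⇓ ins inp y 0 (ℕₚ.+-identityʳ y)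
    in local (local (first ⨾ rest) ⨾ move-exec o y ρ)

  prec-exec : ∀ {f : Rec n} {g k xs y} → prec f g [ k ∷ xs ]⇓ y → ∀ (ins : Fin (suc n) → Fin d) o {ρ} →
              (∀ i → lookup ρ (ins i) ≡ lookup (k ∷ xs) i) → (∀ i → ins i ≢ o) →
              Exec (compile (prec f g) ins o) ρ (add o y ρ)
  prec-exec {k = k} {y = y} p ins o {ρ} inp out =
    let y₀ , first , rest = precLoop-exec p ins (inp ∘ suc) 0 (stop refl)
    in local
      (ends-at (cong (λ c → c + 0 ∷ ρ) (inp zero)) (copy-exec {i = suc (ins zero)} (0 ∷ ρ) λ ()) ⨾
       local (first (k + 0) ⨾ local (rest ⨾ clear-exec zero _) ⨾ move-exec (suc o) y (0 ∷ ρ)))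

  -- The derivation unwinds from the last stage to the first, whereas the loop runs from the first
  -- to the last. Hence the execution after stage k is an argument, and every stage puts its own
  -- round in front of it.
  precLoop-exec : ∀ {f : Rec n} {g k xs y} → prec f g [ k ∷ xs ]⇓ y → ∀ (ins : Fin (suc n) → Fin d) {ρ} →
                  (∀ i → lookup ρ (ins (suc i)) ≡ lookup xs i) →
                  ∀ j {τ} → Exec (precLoop g ins) (k ∷ y ∷ j ∷ ρ) τ →
                  ∃[ y₀ ] (∀ c → Exec (compile f (accArgs ins) zero) (0 ∷ c ∷ ρ) (y₀ ∷ c ∷ ρ)) ×
                    Exec (precLoop g ins) (0 ∷ y₀ ∷ k + j ∷ ρ) τ
  precLoop-exec (⇓prec0 {z = z} f⇓) ins {ρ} inp j rest = z
    , (λ c → ends-at (cong (_∷ c ∷ ρ) (ℕₚ.+-identityʳ z))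
        (compile-exec f⇓ (accArgs ins) zero inp λ _ ()))
    , rest
  precLoop-exec {g = g} (⇓precS {k = k} {y} {z} p g⇓) ins {ρ} inp j {τ} rest =
    let y₀ , first , loops = precLoop-exec p ins inp (suc j) (again refl body rest)
    in y₀ , first , subst (λ c → Exec (precLoop g ins) (0 ∷ y₀ ∷ c ∷ ρ) τ) (ℕₚ.+-suc k j) loops
    where
    args : ∀ i → lookup (0 ∷ k ∷ y ∷ j ∷ ρ) (precArgs ins i) ≡ lookup (k ∷ y ∷ _) i
    args zero          = refl
    args (suc zero)    = refl
    args (suc (suc i)) = inp i
    args≢ : ∀ i → precArgs ins i ≢ zero
    args≢ zero          ()
    args≢ (suc zero)    ()
    args≢ (suc (suc i)) ()
    body : Exec _ (k ∷ y ∷ j ∷ ρ) (suc k ∷ z ∷ j ∷ ρ)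
    body = local
      (ends-at (cong (_∷ k ∷ y ∷ j ∷ ρ) (ℕₚ.+-identityʳ z))
        (compile-exec g⇓ (precArgs ins) zero args args≢) ⨾
       clear-exec (suc (suc zero)) _ ⨾
       ends-at (cong (λ v → 0 ∷ k ∷ v ∷ j ∷ ρ) (ℕₚ.+-identityʳ z))
         (move-exec (suc zero) z (k ∷ 0 ∷ j ∷ ρ))) ⨾ inc

  -- Induction on r, the number of indices still to be refused before the least zero y.
  muLoop-exec : ∀ {f : Rec (suc n)} {xs y} → (∀ k → k ℕ.< y → ∃[ w ] f [ k ∷ xs ]⇓ suc w) → f [ y ∷ xs ]⇓ 0 →
                ∀ (ins : Fin n → Fin d) {ρ} → (∀ i → lookup ρ (ins i) ≡ lookup xs i) → ∀ r i → r + i ≡ y →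
                ∃[ v ] Exec (compile f (muArgs ins) zero) (0 ∷ i ∷ ρ) (v ∷ i ∷ ρ) ×
                  Exec (muLoop f ins) (v ∷ i ∷ ρ) (0 ∷ y ∷ ρ)
  muLoop-exec below f⇓ ins inp zero i refl = 0 , mu-exec f⇓ ins inp , stop refl
  muLoop-exec {f = f} {y = y} below f⇓ ins {ρ} inp (suc r) i eq =
    let v , next , rest = muLoop-exec below f⇓ ins inp r (suc i) (trans (ℕₚ.+-suc r i) eq)
        i<y = subst (i ℕ.<_) eq (ℕ.s≤s (ℕₚ.m≤n+m i r))
    in suc (proj₁ (below i i<y)) , mu-exec (proj₂ (below i i<y)) ins inp
       , again refl (clear-exec zero _ ⨾ inc ⨾ next) rest

  mu-exec : ∀ {f : Rec (suc n)} {i xs v} → f [ i ∷ xs ]⇓ v → ∀ (ins : Fin n → Fin d) {ρ} →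
            (∀ i → lookup ρ (ins i) ≡ lookup xs i) →
            Exec (compile f (muArgs ins) zero) (0 ∷ i ∷ ρ) (v ∷ i ∷ ρ)
  mu-exec {i = i} {xs} {v} f⇓ ins {ρ} inp = ends-at (cong (_∷ i ∷ ρ) (ℕₚ.+-identityʳ v))
    (compile-exec f⇓ (muArgs ins) zero args args≢)
    where
    args : ∀ j → lookup (0 ∷ i ∷ ρ) (muArgs ins j) ≡ lookup (i ∷ xs) j
    args zero    = refl
    args (suc j) = inp j
    args≢ : ∀ j → muArgs ins j ≢ zero
    args≢ zero    ()
    args≢ (suc j) ()

  evaluating-exec : ∀ {gs : Vec (Rec n) m} {xs ys} → gs [ xs ]⇓* ys → ∀ (ins : Fin n → Fin d) {body ρ σ} →
                    (∀ i → lookup ρ (ins i) ≡ lookup xs i) →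
                    Exec body (ys Vec.++ ρ) (ys Vec.++ σ) → Exec (evaluating gs ins body) ρ σ
  evaluating-exec []         ins inp β = β
  evaluating-exec {m = suc m} {ys = y ∷ ys} (g⇓ ∷ gs⇓) ins {ρ = ρ} {σ} inp β = evaluating-exec gs⇓ ins inp
    (local (ends-at (cong (_∷ ys Vec.++ ρ) (ℕₚ.+-identityʳ y))
              (compile-exec g⇓ (λ i → suc (m ↑ʳ ins i)) zero (λ i → trans (Vecₚ.lookup-++ʳ ys ρ (ins i)) (inp i)) λ _ ()) ⨾
            β ⨾ clear-exec zero (y ∷ ys Vec.++ σ)))

-- Compiling programs to counter machines

-- djz r s t decrements r and continues at s, or continues at t if r is zero.
data Instr (L : Set) (R : ℕ) : Set where
  inc : Fin R → L → Instr L R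
  djz : Fin R → L → L → Instr L R

module Code {n R : ℕ} (code : Fin n → Instr (Fin n) R) where

  Conf : Set
  Conf = Fin n × (Fin R → ℕ)

  data CStep : Conf → Conf → Set where
    inc : ∀ {s r t v w} → code s ≡ inc r t → Effect (inc r) v w → CStep (s , v) (t , w)
    dec : ∀ {s r t z v w} → code s ≡ djz r t z → Effect (dec r) v w → CStep (s , v) (t , w)
    zer : ∀ {s r t z v w} → code s ≡ djz r t z → Effect (zero? r) v w → CStep (s , v) (z , w)

  CRun : Conf → Conf → Set
  CRun = Star CStep

  infix 4 _~_
  _~_ : Conf → Conf → Set
  (s , v) ~ (t , w) = s ≡ t × v ≗ w

  dec-zer : ∀ {v w x : Fin R → ℕ} {r} → Effect (dec r) v w → v ≗ x → x r ≡ 0 → ⊥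
  dec-zer {v} {w} {x} {r} d v≗x z with () ← trans (sym z) (trans (sym (v≗x r)) (trans (d r) (cong (_+ w r) (δ-refl r))))

  deterministic : ∀ {c c′ d d′} → CStep c c′ → CStep d d′ → c ~ d → c′ ~ d′
  deterministic (inc {r = r} p e) (inc q f) (refl , v≗) with refl ← trans (sym p) q =
    refl , λ j → trans (e j) (trans (cong (δ r j +_) (v≗ j)) (sym (f j)))
  deterministic (dec {r = r} p e) (dec q f) (refl , v≗) with refl ← trans (sym p) q =
    refl , λ j → ℕₚ.+-cancelˡ-≡ (δ r j) _ _ (trans (sym (e j)) (trans (v≗ j) (f j)))
  deterministic (zer p e) (zer q f) (refl , v≗) with refl ← trans (sym p) q =
    refl , λ j → trans (proj₂ e j) (trans (v≗ j) (sym (proj₂ f j)))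
  deterministic (dec p e) (zer q f) (refl , v≗) with refl ← trans (sym p) q with () ← dec-zer e v≗ (proj₁ f)
  deterministic (zer p e) (dec q f) (refl , v≗) with refl ← trans (sym p) q with () ← dec-zer f (sym ∘ v≗) (proj₁ e)
  deterministic (inc p _) (dec q _) (refl , _) with () ← trans (sym p) q
  deterministic (inc p _) (zer q _) (refl , _) with () ← trans (sym p) q
  deterministic (dec p _) (inc q _) (refl , _) with () ← trans (sym p) q
  deterministic (zer p _) (inc q _) (refl , _) with () ← trans (sym p) q

  -- Every instruction has a successor, so halting is an idle loop.
  Halting : Fin n → Set
  Halting s = ∃[ r ] code s ≡ inc r s

  stays : ∀ {s t v w} → Halting s → CRun (s , v) (t , w) → t ≡ s
  stays h       Star.ε = refl
  stays (r , p) (inc q _ ◅ π) with refl ← trans (sym p) q = stays (r , p) π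
  stays (r , p) (dec q _ ◅ π) with () ← trans (sym p) q
  stays (r , p) (zer q _ ◅ π) with () ← trans (sym p) q

  -- By determinism the two runs advance in step until one of them ends; its halting state is an
  -- idle loop, which the other cannot leave. A run to rejection thus excludes a run to acceptance.
  halts-once : ∀ {c d s t v w} → Halting s → Halting t → c ~ d →
               CRun c (s , v) → CRun d (t , w) → s ≡ t
  halts-once hs ht (refl , _) Star.ε       π       = sym (stays hs π)
  halts-once hs ht (refl , _) (x ◅ π) Star.ε       = stays ht (x ◅ π)
  halts-once hs ht c~d        (x ◅ π) (y ◅ ρ) = halts-once hs ht (deterministic x y c~d) π ρ

  Edge : Set
  Edge = Fin n × Op R × Fin n

  mainEdge sideEdge : Fin n → Instr (Fin n) R → Edge
  mainEdge s (inc r t)   = s , inc r , t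
  mainEdge s (djz r t z) = s , dec r , t
  -- An increment has a single successor; its second edge is a copy of the first.
  sideEdge s (inc r t)   = s , inc r , t
  sideEdge s (djz r t z) = s , zero? r , z

  edge : Fin n ⊎ Fin n → Edge
  edge (inj₁ s) = mainEdge s (code s)
  edge (inj₂ s) = sideEdge s (code s)

  module Edges (start accept : Fin n) where
    machine : CounterMachine
    machine = record
      { states = n
      ; edges  = n + n
      ; regs   = R
      ; src    = proj₁ ∘ edge ∘ splitAt n
      ; tgt    = proj₂ ∘ proj₂ ∘ edge ∘ splitAt n
      ; op     = proj₁ ∘ proj₂ ∘ edge ∘ splitAt n
      ; start  = start
      ; accept = accept
      }

    open CounterMachine machine using (MStep; step)

    mstep : ∀ x {v w} → let s , o , t = edge x in Effect o v w → MStep (s , v) (t , w)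
    mstep x {v} {w} eff = subst (λ y → let s , _ , t = edge y in MStep (s , v) (t , w)) (Finₚ.splitAt-join n n x)
      (step (join n n x) (subst (λ y → Effect (proj₁ (proj₂ (edge y))) v w) (sym (Finₚ.splitAt-join n n x)) eff))

    CStep⇒MStep : ∀ {c d} → CStep c d → MStep c d
    CStep⇒MStep (inc {s} {v = v} {w} p e) with mstep (inj₁ s) {v} {w}
    ... | f rewrite p = f e
    CStep⇒MStep (dec {s} {v = v} {w} p e) with mstep (inj₁ s) {v} {w}
    ... | f rewrite p = f e
    CStep⇒MStep (zer {s} {v = v} {w} p e) with mstep (inj₂ s) {v} {w}
    ... | f rewrite p = f e

    MStep⇒CStep : ∀ {c d} → MStep c d → CStep c d
    MStep⇒CStep (step e eff) = go (splitAt n e) eff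
      where
      go : ∀ x {v w} → let s , o , t = edge x in Effect o v w → CStep (s , v) (t , w)
      go (inj₁ s) eff with code s in eq
      ... | inc r t   = inc eq eff
      ... | djz r t z = dec eq eff
      go (inj₂ s) eff with code s in eq
      ... | inc r t   = inc eq eff
      ... | djz r t z = zer eq eff

-- Programs occupy suc (len p) states and are entered at the first one.
len : Prog d → ℕ
len (inc i)    = 0
len (p ⨾ q)    = len p + suc (len q)
len (loop i p) = suc (len p)
len (local p)  = len p

need : Prog d → ℕ
need (inc i)    = 0
need (p ⨾ q)    = need p + need q
need (loop i p) = need p
need (local p)  = suc (need p)

extend : (Fin d → Fin R) → Fin R → Fin (suc d) → Fin R
extend σ r zero    = r
extend σ r (suc i) = σ i

-- at embeds the states of the program, exit is its continuation,
-- σ allocates its variables and φ its locals.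
instr : (p : Prog d) (at : Fin (suc (len p)) → L) (exit : L)
        (σ : Fin d → Fin R) (φ : Fin (need p) → Fin R) → Fin (suc (len p)) → Instr L R
instr (inc i)    at exit σ φ zero    = inc (σ i) exit
instr (p ⨾ q)    at exit σ φ j with splitAt (suc (len p)) j
... | inj₁ a = instr p (at ∘ (_↑ˡ suc (len q))) (at (suc (len p) ↑ʳ zero)) σ (φ ∘ (_↑ˡ need q)) a
... | inj₂ b = instr q (at ∘ (suc (len p) ↑ʳ_)) exit σ (φ ∘ (need p ↑ʳ_)) b
instr (loop i p) at exit σ φ zero    = djz (σ i) (at (suc zero)) exit
instr (loop i p) at exit σ φ (suc j) = instr p (at ∘ suc) (at zero) σ φ j
instr (local p)  at exit σ φ j       = instr p at exit (extend σ (φ zero)) (φ ∘ suc) j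

record Allocation {d k R} (σ : Fin d → Fin R) (φ : Fin k → Fin R) : Set where
  field
    σ-injective : ∀ {i j} → σ i ≡ σ j → i ≡ j
    φ-injective : ∀ {i j} → φ i ≡ φ j → i ≡ j
    φ≢σ         : ∀ i j → φ i ≢ σ j

open Allocation

-- Correctness of the compiled code

module Simulation {n R : ℕ} (code : Fin n → Instr (Fin n) R) where
  open Code code

  Outside : (Fin d → Fin R) → Fin R → Set
  Outside σ r = ∀ i → r ≢ σ i

  -- `frame` also covers the registers set aside for locals: they are unchanged, hence 0 again, and
  -- the next piece of code may rely on it.
  record Simulated {d} (σ : Fin d → Fin R) (s t : Fin n) (v : Fin R → ℕ) (ρ : Vec ℕ d) : Set where
    field
      final  : Fin R → ℕ
      run    : CRun (s , v) (t , final)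
      stores : ∀ i → final (σ i) ≡ lookup ρ i
      frame  : ∀ r → Outside σ r → final r ≡ v r

  open Simulated

  chained : ∀ {σ : Fin d → Fin R} {s t u v ρ τ} (S : Simulated σ s t v ρ) → Simulated σ t u (final S) τ → Simulated σ s u v τ
  chained S T = record
    { final = final T ; run = run S ◅◅ run T ; stores = stores T
    ; frame = λ r out → trans (frame T r out) (frame S r out) }

  module _ {σ : Fin d → Fin R} (inj : ∀ {i j} → σ i ≡ σ j → i ≡ j) where
    inc-simulated : ∀ {s t v ρ} i → code s ≡ inc (σ i) t → (∀ j → v (σ j) ≡ lookup ρ j) →
                    Simulated σ s t v (updateAt ρ i suc)
    inc-simulated {v = v} {ρ} i c v≡ρ = record
      { final  = λ r → δ (σ i) r + v r
      ; run    = inc c (λ _ → refl) ◅ Star.ε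
      ; stores = stores′
      ; frame  = λ r out → cong (_+ v r) (δ-≢ (out i ∘ sym))
      }
      where
      stores′ : ∀ j → δ (σ i) (σ j) + v (σ j) ≡ lookup (updateAt ρ i suc) j
      stores′ j with i ≟ j
      ... | yes refl = trans (cong₂ _+_ (δ-refl (σ i)) (v≡ρ i)) (sym (Vecₚ.lookup∘updateAt i ρ))
      ... | no i≢j   = trans (cong₂ _+_ (δ-≢ (i≢j ∘ inj)) (v≡ρ j)) (sym (Vecₚ.lookup∘updateAt′ j i (i≢j ∘ sym) ρ))

    dec-simulated : ∀ {s t z v ρ k} i → code s ≡ djz (σ i) t z → (∀ j → v (σ j) ≡ lookup ρ j) →
                    lookup ρ i ≡ suc k → Simulated σ s t v (ρ [ i ]≔ k)
    dec-simulated {v = v} {ρ} {k} i c v≡ρ ρi≡ = record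
      { final  = λ r → v r ∸ δ (σ i) r
      ; run    = dec c effect ◅ Star.ε
      ; stores = stores′
      ; frame  = λ r out → cong (v r ∸_) (δ-≢ (out i ∘ sym))
      }
      where
      effect : Effect (dec (σ i)) v (λ r → v r ∸ δ (σ i) r)
      effect r with σ i ≟ r
      ... | yes refl = trans (trans (v≡ρ i) ρi≡) (cong (λ x → suc (x ∸ 1)) (sym (trans (v≡ρ i) ρi≡)))
      ... | no _     = refl
      stores′ : ∀ j → v (σ j) ∸ δ (σ i) (σ j) ≡ lookup (ρ [ i ]≔ k) j
      stores′ j with i ≟ j
      ... | yes refl = trans (cong₂ _∸_ (trans (v≡ρ i) ρi≡) (δ-refl (σ i))) (sym (Vecₚ.lookup∘update i ρ k))
      ... | no i≢j   = trans (cong₂ _∸_ (v≡ρ j) (δ-≢ (i≢j ∘ inj))) (sym (Vecₚ.lookup∘update′ (i≢j ∘ sym) ρ k))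

  zero-simulated : ∀ {σ : Fin d → Fin R} {s t z v ρ} i → code s ≡ djz (σ i) t z → (∀ j → v (σ j) ≡ lookup ρ j) →
                   lookup ρ i ≡ 0 → Simulated σ s z v ρ
  zero-simulated {v = v} i c v≡ρ ρi≡ = record
    { final = v ; run = zer c (trans (v≡ρ i) ρi≡ , λ _ → refl) ◅ Star.ε ; stores = v≡ρ ; frame = λ _ _ → refl }

  simulate : ∀ {p : Prog d} {ρ τ} → Exec p ρ τ → ∀ at exit σ φ v → Allocation σ φ →
             (∀ j → code (at j) ≡ instr p at exit σ φ j) →
             (∀ i → v (σ i) ≡ lookup ρ i) → (∀ i → v (φ i) ≡ 0) →
             Simulated σ (at zero) exit v τ
  simulate (inc {i = i}) at exit σ φ v α code≡ v≡ρ v≡0 = inc-simulated (σ-injective α) i (code≡ zero) v≡ρ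
  simulate (_⨾_ {p = p} {q} x y) at exit σ φ v α code≡ v≡ρ v≡0 = chained S
    (simulate y (at ∘ (suc (len p) ↑ʳ_)) exit σ (φ ∘ (need p ↑ʳ_)) (final S)
      (record { σ-injective = σ-injective α
              ; φ-injective = Finₚ.↑ʳ-injective (need p) _ _ ∘ φ-injective α
              ; φ≢σ = λ i → φ≢σ α (need p ↑ʳ i) })
      code-q (stores S) (λ i → trans (frame S _ (φ≢σ α (need p ↑ʳ i))) (v≡0 _)))
    where
    code-p : ∀ j → code (at (j ↑ˡ suc (len q))) ≡ instr p _ _ σ _ j
    code-p j with code≡ (j ↑ˡ suc (len q))
    ... | eq rewrite Finₚ.splitAt-↑ˡ (suc (len p)) j (suc (len q)) = eq
    code-q : ∀ j → code (at (suc (len p) ↑ʳ j)) ≡ instr q _ _ σ _ j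
    code-q j with code≡ (suc (len p) ↑ʳ j)
    ... | eq rewrite Finₚ.splitAt-↑ʳ (suc (len p)) (suc (len q)) j = eq
    S = simulate x (at ∘ (_↑ˡ suc (len q))) (at (suc (len p) ↑ʳ zero)) σ (φ ∘ (_↑ˡ need q)) v
      (record { σ-injective = σ-injective α
              ; φ-injective = Finₚ.↑ˡ-injective (need q) _ _ ∘ φ-injective α
              ; φ≢σ = λ i → φ≢σ α (i ↑ˡ need q) })
      code-p v≡ρ (λ i → v≡0 _)
  simulate (stop {i = i} ρi≡0) at exit σ φ v α code≡ v≡ρ v≡0 = zero-simulated i (code≡ zero) v≡ρ ρi≡0
  simulate (again {i = i} {ρ = ρ} ρi≡ x y) at exit σ φ v α code≡ v≡ρ v≡0 = chained (chained S T)
    (simulate y at exit σ φ (final T) α code≡ (stores T)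
      (λ j → trans (frame T _ (φ≢σ α j)) (trans (frame S _ (φ≢σ α j)) (v≡0 j))))
    where
    S = dec-simulated (σ-injective α) {ρ = ρ} i (code≡ zero) v≡ρ ρi≡
    T = simulate x (at ∘ suc) (at zero) σ φ (final S) α (code≡ ∘ suc) (stores S)
      (λ j → trans (frame S _ (φ≢σ α j)) (v≡0 j))
  simulate (local x) at exit σ φ v α code≡ v≡ρ v≡0 = record
    { final = final S ; run = run S ; stores = stores S ∘ suc ; frame = frame′ }
    where
    inj : ∀ i j → extend σ (φ zero) i ≡ extend σ (φ zero) j → i ≡ j
    inj zero    zero    _  = refl
    inj zero    (suc j) eq = contradiction eq (φ≢σ α zero j)
    inj (suc i) zero    eq = contradiction (sym eq) (φ≢σ α zero i)
    inj (suc i) (suc j) eq = cong suc (σ-injective α eq)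
    new : ∀ i j → φ (suc i) ≢ extend σ (φ zero) j
    new i zero    eq with () ← φ-injective α eq
    new i (suc j) eq = φ≢σ α (suc i) j eq
    vars : ∀ i → v (extend σ (φ zero) i) ≡ lookup (0 ∷ _) i
    vars zero    = v≡0 zero
    vars (suc i) = v≡ρ i
    S = simulate x at exit (extend σ (φ zero)) (φ ∘ suc) v
      (record { σ-injective = λ {i} {j} → inj i j
              ; φ-injective = Finₚ.suc-injective ∘ φ-injective α
              ; φ≢σ = new })
      code≡ vars (v≡0 ∘ suc)
    frame′ : ∀ r → Outside σ r → final S r ≡ v r
    frame′ r out with r ≟ φ zero
    -- The register of the local is foreign to the enclosing program; it started at 0 and the rule
    -- for `local` brings it back to 0.
    ... | yes refl = trans (stores S zero) (sym (v≡0 zero))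
    ... | no r≢    = frame S r λ { zero → r≢ ; (suc i) → out i }

-- Diagonalisation

-- Keeping the recursive function, its values and the proof together gives `diagonal` both as a
-- program to compile and as an expression that unfolds to the pairings of the encoding.
record Total (n : ℕ) : Set where
  field
    rec      : Rec n
    fun      : Vec ℕ n → ℕ
    computes : ∀ xs → rec [ xs ]⇓ fun xs

open Total

var : Fin n → Total n
var i = record { rec = proj i ; fun = λ xs → lookup xs i ; computes = λ _ → ⇓proj }

infixr 9 _⊚_

_⊚_ : Total m → Vec (Total n) m → Total n
f ⊚ gs = record
  { rec      = comp (rec f) (Vec.map rec gs)
  ; fun      = λ xs → fun f (Vec.map (λ g → fun g xs) gs)
  ; computes = λ xs → ⇓comp (all gs xs) (computes f _)
  }
  where
  all : ∀ {m n} (gs : Vec (Total n) m) xs → Vec.map rec gs [ xs ]⇓* Vec.map (λ g → fun g xs) gs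
  all []       xs = []
  all (g ∷ gs) xs = computes g xs ∷ all gs xs

successor : Total 1
successor = record { rec = succ ; fun = λ { (x ∷ []) → suc x } ; computes = λ { (x ∷ []) → ⇓succ } }

constant : ℕ → Total n
constant zero    = record { rec = zer ; fun = λ _ → 0 ; computes = λ { [] → ⇓zer } } ⊚ []
constant (suc k) = successor ⊚ (constant k ∷ [])

-- The function f is supplied rather than defined by the recursion, so that values take the form in
-- which the encoding states them, such as `triangle`.
primrec : (g : Total n) (h : Total (2 + n)) (f : Vec ℕ (suc n) → ℕ) →
          (∀ xs → fun g xs ≡ f (0 ∷ xs)) → (∀ k xs → fun h (k ∷ f (k ∷ xs) ∷ xs) ≡ f (suc k ∷ xs)) →
          Total (suc n)
primrec g h f base next = record
  { rec      = prec (rec g) (rec h)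
  ; fun      = f
  ; computes = λ { (k ∷ xs) → go k xs }
  }
  where
  go : ∀ k xs → prec (rec g) (rec h) [ k ∷ xs ]⇓ f (k ∷ xs)
  go zero    xs = subst (_ [ 0 ∷ xs ]⇓_) (base xs) (⇓prec0 (computes g xs))
  go (suc k) xs = subst (_ [ suc k ∷ xs ]⇓_) (next k xs) (⇓precS (go k xs) (computes h _))

addition : Total 2
addition = primrec (var zero) (successor ⊚ (var (suc zero) ∷ [])) (λ { (a ∷ b ∷ []) → a + b })
  (λ { (b ∷ []) → refl }) (λ { k (b ∷ []) → refl })

triangular : Total 1
triangular = primrec (constant 0) (addition ⊚ (successor ⊚ (var zero ∷ []) ∷ var (suc zero) ∷ []))
  (λ { (k ∷ []) → triangle k }) (λ { [] → refl }) (λ { k [] → refl })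

pairing : Total 2
pairing = addition ⊚ (triangular ⊚ (addition ∷ []) ∷ var (suc zero) ∷ [])

infixr 6 _&_

_&_ : Total n → Total n → Total n
f & g = pairing ⊚ (f ∷ g ∷ [])

-- The code of a list with k entries of code p put in front of a list of code e.
prepend : ℕ → ℕ → ℕ → ℕ
prepend zero    p e = e
prepend (suc k) p e = suc ⟨ p , prepend k p e ⟩

prepending : ℕ → Total n → Total n → Total n
prepending p k e = primrec (var zero) (successor ⊚ (constant p & var (suc zero) ∷ []))
  (λ { (k ∷ e ∷ []) → prepend k p e }) (λ { (e ∷ []) → refl }) (λ { k (e ∷ []) → step k e }) ⊚ (k ∷ e ∷ [])
  where
  constant-fun : ∀ {n} k (xs : Vec ℕ n) → fun (constant k) xs ≡ k
  constant-fun zero    xs = refl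
  constant-fun (suc k) xs = cong suc (constant-fun k xs)
  step : ∀ k e → suc ⟨ fun (constant p) (k ∷ prepend k p e ∷ e ∷ []) , prepend k p e ⟩ ≡ suc ⟨ p , prepend k p e ⟩
  step k e = cong (λ c → suc ⟨ c , prepend k p e ⟩) (constant-fun p (k ∷ prepend k p e ∷ e ∷ []))

-- The code of the arc `fresh` at place number p.
arcCode : ℕ → ℕ
arcCode p = ⟨ p , ⟨ ⟨ 0 , 0 ⟩ , ⟨ 0 , 0 ⟩ ⟩ ⟩

-- The code of an instance with a control-states, code b for the place costs and code c for
-- the transitions after the first one, which loads a, b and c; 4 and 1 are the control-states
-- reached by loading and by acceptance.
diagonal : Total 3
diagonal = (a & b & successor ⊚ (((zero′ & constant 4 & zero′ & zero′ & arcs) & (zero′ & zero′)) & c ∷ [])) &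
           zero′ & constant 1 & zero′
  where
  a b c zero′ arcs : Total 3
  a = var zero
  b = var (suc zero)
  c = var (suc (suc zero))
  zero′ = constant 0
  -- Place 0 is the clock and place 1 the output register, so the inputs are on places 2, 3 and 4.
  arcs = prepending (arcCode 2) a (prepending (arcCode 3) b (prepending (arcCode 4) c zero′))

-- Abstract, as unfolding the pairing function on the actual codes is infeasible.
abstract
  shape : (states costs loading rest start accept : ℕ) → ℕ
  shape q p l r s t =
    ⟨ ⟨ q , ⟨ p , suc ⟨ ⟨ ⟨ 0 , ⟨ s , ⟨ 0 , ⟨ 0 , l ⟩ ⟩ ⟩ ⟩ , ⟨ 0 , 0 ⟩ ⟩ , r ⟩ ⟩ ⟩ , ⟨ 0 , ⟨ t , 0 ⟩ ⟩ ⟩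

  diagonal-shape : ∀ a b c → shape a b (prepend a (arcCode 2) (prepend b (arcCode 3) (prepend c (arcCode 4) 0))) c 4 1 ≡
                   fun diagonal (a ∷ b ∷ c ∷ [])
  diagonal-shape a b c = refl

-- The code of a net and its dependence on the load

module Loading (𝓜 : CounterMachine) (load : List (Fin (CounterMachine.regs 𝓜))) where
  open CounterMachine 𝓜
  module N = Net 𝓜 load

  restCode : ℕ
  restCode = encodeList (tabulate λ i →
    ⟨ encodeTransition (N.transitionOf (N.decodeTrans (suc i))) , encodeℤ (N.transCost (N.decodeTrans (suc i))) ⟩)

  costCode : ℕ
  costCode = encodeList (tabulate (PTPN.costP N.net))

  loadCode : List (Fin regs) → ℕ
  loadCode l = encodeArcs (map (N.fresh ∘ suc) l)

  loadCode-replicate : ∀ k r l → loadCode (replicate k r ++ l) ≡ prepend k (arcCode (suc (toℕ r))) (loadCode l)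
  loadCode-replicate zero    r l = refl
  loadCode-replicate (suc k) r l = cong (λ e → suc ⟨ arcCode (suc (toℕ r)) , e ⟩) (loadCode-replicate k r l)

  abstract
    encode-shape : encode N.inst ≡ shape N.states′ costCode (loadCode load) restCode
                     (toℕ (N.encodeCtrl (N.norm start))) (toℕ (N.encodeCtrl (N.norm accept)))
    encode-shape = refl

costCode-load : ∀ 𝓜 l l′ → Loading.costCode 𝓜 l ≡ Loading.costCode 𝓜 l′
costCode-load 𝓜 l l′ = refl

-- Only `loading` mentions the load, and it has index 0. This independence is what makes the
-- self-reference possible.
restCode-load : ∀ 𝓜 l l′ → Loading.restCode 𝓜 l ≡ Loading.restCode 𝓜 l′
restCode-load 𝓜 l l′ = cong encodeList (Listₚ.tabulate-cong λ i → go (Fin.remQuot kinds i))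
  where
  open CounterMachine 𝓜
  module N  = Net 𝓜 l
  module N′ = Net 𝓜 l′
  open N using (kinds)
  inputs : ∀ o → encodeArcs (N.inputs o) ≡ encodeArcs (N′.inputs o)
  inputs (inc r)   = refl
  inputs (dec r)   = refl
  inputs (zero? r) = refl
  outputs : ∀ o → encodeArcs (N.outputs o) ≡ encodeArcs (N′.outputs o)
  outputs (inc r)   = refl
  outputs (dec r)   = refl
  outputs (zero? r) = refl
  refunds : ∀ o r → N.refund (N.refundable o (suc r)) ≡ N′.refund (N′.refundable o (suc r))
  refunds (inc r)   j = refl
  refunds (dec r)   j = refl
  refunds (zero? r) j with does (r Fin.≟ j)
  ... | true  = refl
  ... | false = refl
  go : ∀ ek → let t = uncurry N.kind ek ; t′ = uncurry N′.kind ek in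
       ⟨ encodeTransition (N.transitionOf t) , encodeℤ (N.transCost t) ⟩ ≡
       ⟨ encodeTransition (N′.transitionOf t′) , encodeℤ (N′.transCost t′) ⟩
  go (e , zero)                = refl
  go (e , suc zero)            = refl
  go (e , suc (suc zero))      = cong₂ (λ i o → ⟨ ⟨ s , ⟨ t , ⟨ i , ⟨ 0 , o ⟩ ⟩ ⟩ ⟩ , ⟨ 0 , 0 ⟩ ⟩) (inputs (op e)) (outputs (op e))
    where
    s = toℕ (N.encodeCtrl (N.work e))
    t = toℕ (N.encodeCtrl (N.norm (tgt e)))
  go (e , suc (suc (suc r))) =
    cong (λ c → ⟨ encodeTransition (N.transitionOf (N.credit e r)) , encodeℤ c ⟩) (refunds (op e) r)

-- The net that contains its own description

#-replicate : ∀ {k} a (r j : Fin k) → replicate a r # j ≡ a * δ r j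
#-replicate zero    r j = refl
#-replicate (suc a) r j = cong (λ x → δ r j + x) (#-replicate a r j)

-- Input and program are parameters, since unfolding the actual ones is infeasible.
module Test (p : Prog 4) where
  -- Register 0 receives the output and registers 1 to 3 hold a, b, c. Positions 0 to 2 accept,
  -- reject and test; since `init` shifts control-states by one, `start` and `accept` become 4 and
  -- 1.
  registers positions : ℕ
  registers = 4 + need p
  positions = 3 + suc (len p)

  σ : Fin 4 → Fin registers
  σ = _↑ˡ need p

  φ : Fin (need p) → Fin registers
  φ = 4 ↑ʳ_

  accept reject test start : Fin positions
  accept = zero
  reject = suc zero
  test   = suc (suc zero)
  start  = 3 ↑ʳ zero

  code : Fin positions → Instr (Fin positions) registers
  code zero                = inc (σ zero) accept
  code (suc zero)          = inc (σ zero) reject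
  -- The answer is inverted: output 0, the claim that the net is not cheap, leads to acceptance and
  -- makes it cheap.
  code (suc (suc zero))    = djz (σ zero) reject accept
  code (suc (suc (suc j))) = instr p (3 ↑ʳ_) test σ φ j

  open Code code
  open Edges start accept public
  open Simulation code

  first : Fin 3 → Fin registers
  first i = σ (suc i)

  module Inputs (a b c : ℕ) where
    load : List (Fin registers)
    load = replicate a (first zero) ++ replicate b (first (suc zero)) ++ replicate c (first (suc (suc zero))) ++ []

    open Net machine load using (inst)

    load-# : ∀ j → load # j ≡ a * δ (first zero) j + (b * δ (first (suc zero)) j + (c * δ (first (suc (suc zero))) j + 0))
    load-# j =
      trans (#-++ (replicate a (first zero)) _ j) (cong₂ _+_ (#-replicate a (first zero) j)
      (trans (#-++ (replicate b (first (suc zero))) _ j) (cong₂ _+_ (#-replicate b (first (suc zero)) j)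
      (trans (#-++ (replicate c (first (suc (suc zero)))) [] j)
             (cong (_+ 0) (#-replicate c (first (suc (suc zero))) j))))))

    simulated : ∀ {y} → Exec p (0 ∷ a ∷ b ∷ c ∷ []) (y ∷ a ∷ b ∷ c ∷ []) → Simulated σ start test (load #_) (y ∷ a ∷ b ∷ c ∷ [])
    simulated x = simulate x
      (3 ↑ʳ_) test σ φ (load #_)
      (record { σ-injective = Finₚ.↑ˡ-injective (need p) _ _
              ; φ-injective = Finₚ.↑ʳ-injective 4 _ _
              ; φ≢σ         = disjoint })
      (λ _ → refl) inputs (λ i → trans (load-# (φ i)) zeros)
      where
      disjoint : ∀ i j → φ i ≢ σ j
      disjoint i (suc (suc (suc (suc ()))))
      zeros : a * 0 + (b * 0 + (c * 0 + 0)) ≡ 0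
      zeros rewrite ℕₚ.*-zeroʳ a | ℕₚ.*-zeroʳ b | ℕₚ.*-zeroʳ c = refl
      inputs : ∀ i → load # σ i ≡ lookup (0 ∷ a ∷ b ∷ c ∷ []) i
      inputs zero = trans (load-# (σ zero)) zeros
      inputs (suc zero) = trans (load-# (first zero)) a+0
        where
        a+0 : a * 1 + (b * 0 + (c * 0 + 0)) ≡ a
        a+0 rewrite ℕₚ.*-zeroʳ b | ℕₚ.*-zeroʳ c | ℕₚ.*-identityʳ a = ℕₚ.+-identityʳ a
      inputs (suc (suc zero)) = trans (load-# (first (suc zero))) b+0
        where
        b+0 : a * 0 + (b * 1 + (c * 0 + 0)) ≡ b
        b+0 rewrite ℕₚ.*-zeroʳ a | ℕₚ.*-zeroʳ c | ℕₚ.*-identityʳ b = ℕₚ.+-identityʳ b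
      inputs (suc (suc (suc zero))) = trans (load-# (first (suc (suc zero)))) c+0
        where
        c+0 : a * 0 + (b * 0 + (c * 1 + 0)) ≡ c
        c+0 rewrite ℕₚ.*-zeroʳ a | ℕₚ.*-zeroʳ b | ℕₚ.*-identityʳ c = ℕₚ.+-identityʳ c

    open Simulated

    accepts : Exec p (0 ∷ a ∷ b ∷ c ∷ []) (0 ∷ a ∷ b ∷ c ∷ []) → CostThreshold inst
    accepts x = Completeness.complete machine load
      (Star.map CStep⇒MStep (run S ◅◅ zer refl (stores S zero , λ _ → refl) ◅ Star.ε))
      where S = simulated x

    rejects : Exec p (0 ∷ a ∷ b ∷ c ∷ []) (1 ∷ a ∷ b ∷ c ∷ []) → ¬ CostThreshold inst
    rejects x = Soundness.sound machine load λ ρ π → contradiction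
      (halts-once (σ zero , refl) (σ zero , refl) (refl , λ _ → refl)
        (run S ◅◅ dec {w = λ r → final S r ℕ.∸ δ (σ zero) r} refl effect ◅ Star.ε) (Star.map MStep⇒CStep π))
      λ ()
      where
      S = simulated x
      effect : Effect (dec (σ zero)) (final S) (λ r → final S r ℕ.∸ δ (σ zero) r)
      effect zero    = trans (stores S zero) (cong (λ x → suc (x ℕ.∸ 1)) (sym (stores S zero)))
      effect (suc r) = refl

  abstract
    a b c : ℕ
    a = Net.states′ machine []
    b = Loading.costCode machine []
    c = Loading.restCode machine []

    states′≡a : ∀ l → Net.states′ machine l ≡ a
    states′≡a l = refl

    costCode≡b : ∀ l → Loading.costCode machine l ≡ b
    costCode≡b l = costCode-load machine l []

    restCode≡c : ∀ l → Loading.restCode machine l ≡ c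
    restCode≡c l = restCode-load machine l []

  open Inputs a b c public

  inst : Instance
  inst = Net.inst machine load

  loadCode-load : Loading.loadCode machine load load ≡
                  prepend a (arcCode 2) (prepend b (arcCode 3) (prepend c (arcCode 4) 0))
  loadCode-load = trans (loadCode-replicate a (first zero) _) (cong (prepend a (arcCode 2))
    (trans (loadCode-replicate b (first (suc zero)) _) (cong (prepend b (arcCode 3))
      (loadCode-replicate c (first (suc (suc zero))) []))))
    where open Loading machine load using (loadCode-replicate)

  shape-cong : ∀ {q q′ p p′ l l′ r r′} s t → q ≡ q′ → p ≡ p′ → l ≡ l′ → r ≡ r′ →
               shape q p l r s t ≡ shape q′ p′ l′ r′ s t
  shape-cong s t refl refl refl refl = refl

  -- The program in this net computes on a, b, c the code of the net itself.
  encode-inst : encode inst ≡ fun diagonal (a ∷ b ∷ c ∷ [])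
  encode-inst = trans (Loading.encode-shape machine load) (trans
    (shape-cong 4 1 (states′≡a load) (costCode≡b load) loadCode-load (restCode≡c load))
    (diagonal-shape a b c))

module Diagonal (f : Rec 1) where
  abstract
    p : Prog 4
    p = compile (comp f (rec diagonal ∷ [])) suc zero

    p-exec : ∀ {a b c y} → f [ fun diagonal (a ∷ b ∷ c ∷ []) ∷ [] ]⇓ y →
             Exec p (0 ∷ a ∷ b ∷ c ∷ []) (y ∷ a ∷ b ∷ c ∷ [])
    p-exec {a} {b} {c} {y} f⇓ = ends-at (cong (_∷ a ∷ b ∷ c ∷ []) (ℕₚ.+-identityʳ y))
      (compile-exec (⇓comp (computes diagonal (a ∷ b ∷ c ∷ []) ∷ []) f⇓) suc zero
        {0 ∷ a ∷ b ∷ c ∷ []} (λ _ → refl) (λ _ ()))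

  open Test p public

open Diagonal

theorem10p1 : Undecidable encode CostThreshold
theorem10p1 (f , decides) = [ contradicts₁ , contradicts₀ ]′ (decides (inst f))
  where
  contradicts₁ : f [ encode (inst f) ∷ [] ]⇓ 1 × CostThreshold (inst f) → ⊥
  contradicts₁ (⇓1 , cheap) = rejects f (p-exec f (subst (λ e → f [ e ∷ [] ]⇓ 1) (encode-inst f) ⇓1)) cheap
  contradicts₀ : f [ encode (inst f) ∷ [] ]⇓ 0 × ¬ CostThreshold (inst f) → ⊥
  contradicts₀ (⇓0 , expensive) = expensive (accepts f (p-exec f (subst (λ e → f [ e ∷ [] ]⇓ 0) (encode-inst f) ⇓0)))
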